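{- For every positive integer $n\neq 5$, the maximum number of edges in an $n$-vertex graph containing no subgraph isomorphic to $P^2_6$ is $$\mathrm{ex}(n,P^2_6)=\begin{cases}\left\lfloor \frac{n^2}{4}\right\rfloor+\left\lfloor\frac{n-1}{2}\right\rfloor, & n\equiv 1,2,3 \pmod 6,\\[2pt] \left\lfloor \frac{n^2}{4}\right\rfloor+\left\lceil\frac{n}{2}\right\rceil, & \text{otherwise.}\end{cases}$$
   Context: All graphs are finite, simple and undirected. $P^2_k$ is the square of the path on $k$ vertices $v_1,\dots,v_k$: $v_i,v_j$ adjacent iff $1\le |i-j|\le 2$. $\mathrm{ex}(n,H)$ is the maximum number of edges in an $n$-vertex graph not containing $H$ as a subgraph. -}

module Defs where

open import Data.Nat using (ℕ; _+_; _*_; _∸_; _≤_; _<_; _<ᵇ_)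
open import Data.Nat.DivMod using (_/_; _%_)
open import Data.Bool using (Bool; true; false; if_then_else_; _∧_)
open import Data.Fin using (Fin; toℕ; zero; suc)
open import Data.Product using (Σ; _×_; ∃)
open import Relation.Binary.PropositionalEquality using (_≡_)
open import Function.Definitions using (Injective)
open import Relation.Nullary using (¬_)
open import Data.Nat.Properties using (+-comm; n∸n≡0)
open import Relation.Binary.PropositionalEquality using (cong; refl)

record Graph (n : ℕ) : Set where
  field
    adj   : Fin n → Fin n → Bool
    sym   : ∀ i j → adj i j ≡ adj j i
    irrefl : ∀ i → adj i i ≡ false
open Graph public

sumFin : (n : ℕ) → (Fin n → ℕ) → ℕ
sumFin ℕ.zero f = 0
sumFin (ℕ.suc n) f = f zero + sumFin n (λ i → f (suc i))

edges : ∀ {n} → Graph n → ℕ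
edges {n} G = sumFin n (λ i → sumFin n (λ j →
  if (toℕ i <ᵇ toℕ j) ∧ adj G i j then 1 else 0))

_⊆G_ : ∀ {k n} → Graph k → Graph n → Set
_⊆G_ {k} {n} H G = Σ (Fin k → Fin n) λ f →
  Injective _≡_ _≡_ f × (∀ i j → adj H i j ≡ true → adj G (f i) (f j) ≡ true)

-- square of a path on k vertices: i ~ j iff 1 ≤ |i - j| ≤ 2
dist : ℕ → ℕ → ℕ
dist a b = (a ∸ b) + (b ∸ a)

P²-adj : ∀ {k} → Fin k → Fin k → Bool
P²-adj i j = (0 <ᵇ dist (toℕ i) (toℕ j)) ∧ (dist (toℕ i) (toℕ j) <ᵇ 3)


dist-sym : ∀ a b → dist a b ≡ dist b a
dist-sym a b = +-comm (a ∸ b) (b ∸ a)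

dist-self : ∀ a → dist a a ≡ 0
dist-self a rewrite n∸n≡0 a = refl

P² : (k : ℕ) → Graph k
P² k = record
  { adj = P²-adj
  ; sym = λ i j → cong (λ d → (0 <ᵇ d) ∧ (d <ᵇ 3)) (dist-sym (toℕ i) (toℕ j))
  ; irrefl = λ i → cong (λ d → (0 <ᵇ d) ∧ (d <ᵇ 3)) (dist-self (toℕ i))
  }

IsEx : (n : ℕ) → ∀ {k} → Graph k → ℕ → Set
IsEx n H m =
  (Σ (Graph n) λ G → ¬ (H ⊆G G) × edges G ≡ m)
  × (∀ (G : Graph n) → ¬ (H ⊆G G) → edges G ≤ m)

exP6 : ℕ → ℕ
exP6 n with n % 6
... | 1 = (n * n) / 4 + (n ∸ 1) / 2
... | 2 = (n * n) / 4 + (n ∸ 1) / 2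
... | 3 = (n * n) / 4 + (n ∸ 1) / 2
... | _ = (n * n) / 4 + (n + 1) / 2

{-# OPTIONS --safe #-}
module Submission where

-- Induct on n along residues mod 6. A vertex of degree at most exP6 n − exP6 (n − 1) can be deleted, so
-- assume a minimum degree p slightly above n/2; then every edge lies in many triangles. For n ≡ 3, 4, 5
-- (2p ≥ n + 3) a copy of the square is built greedily, failing only inside a K₅, which is excluded by
-- counting. For n ≡ 0, 1, 2 one deletes 3, 4 or 5 vertices that meet few edges: K₅ or K₅ minus an edge, or
-- a triangle, near a K₄; otherwise a 4-cycle in the neighbourhood of a vertex of large degree, or (for odd n,
-- when there is no such vertex) a triangle of minimum-degree vertices.

-- The obstacle is n = 5: K₅ has 10 edges and the formula gives 9, so no deletion may lead to 5
-- vertices, and n = 6 is settled by a finite check instead. With p the minimum degree that may be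
-- assumed, 2p is n + 1 for n ≡ 1, n + 2 for n ≡ 0, 2, and at least n + 3 for n ≡ 3, 4, 5; this
-- decides which argument is available. Losses are bounded through pairs of vertices. If all common
-- neighbours of a pair lie among k given vertices, its degree sum is at most n + k. The forbidden
-- square yields such pairs with k = 1 or 2, because one more common neighbour would be the last
-- vertex of a copy. A pair with k = 1 contradicts 2p = n + 2, so for n ≡ 0, 2 only deletions of
-- five vertices survive; in particular 8 never drops to 5 by losing a triangle. For n ≡ 1 the
-- deletions of 3, 4 and 5 vertices lead to the residues 4, 3 and 2.

open import Defs hiding (adj; sym)
open import Data.Bool as Bool using (Bool; true; false; not; _∧_; if_then_else_)
open import Data.Empty using (⊥; ⊥-elim)
open import Data.Fin as Fin using (Fin; zero; suc; #_; toℕ)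
open import Data.Fin.Patterns using (0F; 1F; 2F; 3F; 4F; 5F)
open import Data.Fin.Properties using (injective⇒≤)
open import Data.List using (List; []; _∷_; _++_; length; map; tabulate)
open import Data.List.Membership.Propositional using (_∈_; find; lose)
open import Data.List.Membership.Propositional.Properties using (∈-∃++)
open import Data.List.Properties using (length-++; length-tabulate)
open import Data.List.Relation.Binary.Permutation.Propositional
  using (_↭_; refl; prep; swap; ↭-refl; ↭-trans; ↭⇒↭ₛ)
  renaming (trans to _then_)
open import Data.List.Relation.Binary.Permutation.Propositional.Properties
  using (∈-resp-↭; shift; ↭-length; map⁺; All-resp-↭)
open import Data.List.Relation.Binary.Permutation.Setoid.Properties using (AllPairs-resp-↭; Unique-resp-↭)
open import Data.List.Relation.Unary.All as All using (All; []; _∷_)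
open import Data.List.Relation.Unary.AllPairs as AllPairs using (AllPairs; []; _∷_)
open import Data.List.Relation.Unary.Any using (Any; here; there; any?; satisfied)
open import Data.List.Relation.Unary.Unique.Propositional using (Unique)
open import Data.List.Relation.Unary.Unique.Propositional.Properties using (allFin⁺)
open import Data.Nat as ℕ hiding (_≟_)
open import Data.Nat.Divisibility using (n∣m*n)
open import Data.Nat.DivMod
open import Data.Nat.ListAction using (sum)
open import Data.Nat.ListAction.Properties using (sum-↭)
open import Data.Nat.Properties hiding (_≟_)
open import Algebra.Properties.CommutativeSemigroup +-commutativeSemigroup using (interchange)
open import Data.Nat.Tactic.RingSolver using (solve-∀)
open import Data.Product using (∃; ∃-syntax; _×_; _,_; proj₁; proj₂)
open import Data.Vec as Vec using (Vec; []; _∷_)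
open import Data.Vec.Properties using (lookup-map)
open import Data.Vec.Relation.Unary.All using ([]; _∷_)
open import Data.Vec.Relation.Unary.All.Properties using (fromList⁺)
open import Data.Vec.Relation.Unary.AllPairs using ([]; _∷_)
open import Data.Vec.Relation.Unary.Unique.Propositional using () renaming (Unique to Uniqueᵛ)
open import Data.Vec.Relation.Unary.Unique.Propositional.Properties using (lookup-injective)
open import Function using (_∘_)
open import Relation.Binary.Definitions using (DecidableEquality)
open import Relation.Binary.PropositionalEquality
  using (_≡_; _≢_; refl; sym; trans; cong; cong₂; subst; setoid)
open import Relation.Nullary using (Dec; ¬_; ¬?; yes; no; does)
open import Relation.Nullary.Decidable
  using (dec-true; dec-false; decidable-stable; from-yes; map′; _×-dec_)

-- Sums over lists

[_] : Bool → ℕ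
[ b ] = if b then 1 else 0

module _ {A : Set} where

  ∑ : List A → (A → ℕ) → ℕ
  ∑ xs f = sum (map f xs)

  ∑-+ : ∀ xs (f g : A → ℕ) → ∑ xs (λ v → f v + g v) ≡ ∑ xs f + ∑ xs g
  ∑-+ [] f g = refl
  ∑-+ (x ∷ xs) f g rewrite ∑-+ xs f g = interchange (f x) (g x) (∑ xs f) (∑ xs g)

  ∑-++ : ∀ xs ys (f : A → ℕ) → ∑ (xs ++ ys) f ≡ ∑ xs f + ∑ ys f
  ∑-++ [] ys f = refl
  ∑-++ (x ∷ xs) ys f rewrite ∑-++ xs ys f = sym (+-assoc (f x) _ _)

  ∑-↭ : ∀ {xs ys} (f : A → ℕ) → xs ↭ ys → ∑ xs f ≡ ∑ ys f
  ∑-↭ f xs↭ys = sum-↭ (map⁺ f xs↭ys)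

  ∑-suc-* : ∀ xs c (f : A → ℕ) → ∑ xs (λ v → suc (c * f v)) ≡ length xs + c * ∑ xs f
  ∑-suc-* [] c f = sym (*-zeroʳ c)
  ∑-suc-* (x ∷ xs) c f rewrite ∑-suc-* xs c f = lemma c (f x) (length xs) (∑ xs f)
    where
    lemma : ∀ c a l s → suc (c * a) + (l + c * s) ≡ suc l + c * (a + s)
    lemma = solve-∀

  ∑-pigeonhole : ∀ xs (f g : A → ℕ) → ∑ xs g < ∑ xs f → ∃[ v ] v ∈ xs × g v < f v
  ∑-pigeonhole (x ∷ xs) f g lt with g x <? f x
  ... | yes gx<fx = x , here refl , gx<fx
  ... | no gx≮fx =
    let v , v∈xs , gv<fv = ∑-pigeonhole xs f g
          (+-cancelˡ-< (g x) _ _ (<-≤-trans lt (+-monoˡ-≤ _ (≮⇒≥ gx≮fx))))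
    in v , there v∈xs , gv<fv

  unique-↭ : ∀ {xs ys : List A} → xs ↭ ys → Unique xs → Unique ys
  unique-↭ xs↭ys = Unique-resp-↭ (setoid A) (↭⇒↭ₛ xs↭ys)

  unique-++ʳ : ∀ (xs : List A) {ys} → Unique (xs ++ ys) → Unique ys
  unique-++ʳ [] uniq = uniq
  unique-++ʳ (x ∷ xs) (_ ∷ uniq) = unique-++ʳ xs uniq

  extract : ∀ {xs S : List A} → Unique xs → All (_∈ S) xs → ∃[ R ] S ↭ xs ++ R
  extract {[]} {S} [] [] = S , ↭-refl
  extract {x ∷ xs} (x≢xs ∷ uniq) (x∈S ∷ xs⊆S) with ∈-∃++ x∈S
  ... | ys , zs , refl =
    let xs⊆ = All.map (λ (x≢y , y∈) → drop-head (x≢y ∘ sym) (∈-resp-↭ (shift x ys zs) y∈))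
                (All.zip (x≢xs , xs⊆S))
        R , rest = extract uniq xs⊆
    in R , ↭-trans (shift x ys zs) (prep x rest)
    where
    drop-head : ∀ {y x : A} {L} → y ≢ x → y ∈ x ∷ L → y ∈ L
    drop-head y≢x (here y≡x) = ⊥-elim (y≢x y≡x)
    drop-head y≢x (there y∈L) = y∈L

∑-cong : ∀ {A : Set} (xs : List A) {f g : A → ℕ} → (∀ x → f x ≡ g x) → ∑ xs f ≡ ∑ xs g
∑-cong [] f≗g = refl
∑-cong (x ∷ xs) f≗g = cong₂ _+_ (f≗g x) (∑-cong xs f≗g)

∑-swap : ∀ {A B : Set} (xs : List A) (ys : List B) (f : A → B → ℕ) →
  ∑ xs (λ x → ∑ ys (f x)) ≡ ∑ ys (λ y → ∑ xs (λ x → f x y))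
∑-swap [] [] f = refl
∑-swap [] (y ∷ ys) f = ∑-swap [] ys f
∑-swap (x ∷ xs) ys f
  rewrite ∑-swap xs ys f = sym (∑-+ ys (f x) (λ y → ∑ xs (λ x′ → f x′ y)))

∑-lower : ∀ {A : Set} {xs : List A} {f : A → ℕ} {p} → All (λ x → p ≤ f x) xs →
  length xs * p ≤ ∑ xs f
∑-lower [] = z≤n
∑-lower (p≤ ∷ ps) = +-mono-≤ p≤ (∑-lower ps)

module Occurrences {A : Set} (_≟_ : DecidableEquality A) where

  occ : List A → A → ℕ
  occ ex v = ∑ ex (λ w → [ does (v ≟ w) ])

  ∑-≟≤1 : ∀ {xs} → Unique xs → ∀ w → ∑ xs (λ v → [ does (v ≟ w) ]) ≤ 1
  ∑-≟≤1 [] w = z≤n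
  ∑-≟≤1 {x ∷ xs} (x≢xs ∷ uniq) w with x ≟ w
  ... | no _ = ∑-≟≤1 uniq w
  ... | yes refl = s≤s (≤-reflexive (absent x≢xs))
    where
    absent : ∀ {ys} → All (x ≢_) ys → ∑ ys (λ v → [ does (v ≟ x) ]) ≡ 0
    absent [] = refl
    absent {y ∷ ys} (x≢y ∷ x≢ys) with y ≟ x
    ... | yes y≡x = ⊥-elim (x≢y (sym y≡x))
    ... | no _ = absent x≢ys

  1≤∑-≟ : ∀ {xs w} → w ∈ xs → 1 ≤ ∑ xs (λ v → [ does (v ≟ w) ])
  1≤∑-≟ {x ∷ xs} {w} w∈ with x ≟ w | w∈
  ... | yes _ | _ = s≤s z≤n
  ... | no x≢w | here w≡x = ⊥-elim (x≢w (sym w≡x))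
  ... | no _ | there w∈xs = 1≤∑-≟ w∈xs

  ∑-occ : ∀ {xs} → Unique xs → ∀ ex → ∑ xs (occ ex) ≤ length ex
  ∑-occ {xs} uniq [] = ≤-reflexive (zeros xs)
    where
    zeros : ∀ ys → ∑ ys (λ _ → 0) ≡ 0
    zeros [] = refl
    zeros (_ ∷ ys) = zeros ys
  ∑-occ {xs} uniq (w ∷ ex)
    rewrite ∑-+ xs (λ v → [ does (v ≟ w) ]) (occ ex) = +-mono-≤ (∑-≟≤1 uniq w) (∑-occ uniq ex)

  occ≡0⇒≢ : ∀ ex {v} → occ ex v ≡ 0 → All (v ≢_) ex
  occ≡0⇒≢ [] _ = []
  occ≡0⇒≢ (w ∷ ex) {v} eq with v ≟ w
  ... | no v≢w = v≢w ∷ occ≡0⇒≢ ex eq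

  -- Each vertex gets the allowance 1, plus c for every time it is listed in `ex`. A duplicate-free
  -- list meets each entry of `ex` at most once, so excluding a vertex from a degree count costs at
  -- most c.
  weighted-pigeonhole : ∀ {xs} → Unique xs → ∀ ex c (f : A → ℕ) →
    length xs + c * length ex < ∑ xs f → ∃[ v ] v ∈ xs × suc (c * occ ex v) < f v
  weighted-pigeonhole {xs} uniq ex c f lt = ∑-pigeonhole xs f _ (begin-strict
    ∑ xs (λ v → suc (c * occ ex v)) ≡⟨ ∑-suc-* xs c (occ ex) ⟩
    length xs + c * ∑ xs (occ ex)   ≤⟨ +-monoʳ-≤ (length xs) (*-monoʳ-≤ c (∑-occ uniq ex)) ⟩
    length xs + c * length ex       <⟨ lt ⟩
    ∑ xs f                          ∎)
    where open ≤-Reasoning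

-- Induced subgraphs are given by duplicate-free lists of vertices, on which E counts the edges.
module EdgeCount {A : Set} (adj : A → A → Bool)
  (adj-sym : ∀ x y → adj x y ≡ adj y x) (adj-irrefl : ∀ x → adj x x ≡ false) where

  D : A → List A → ℕ
  D x xs = ∑ xs (λ v → [ adj x v ])

  E : List A → ℕ
  E [] = 0
  E (x ∷ xs) = D x xs + E xs

  E-↭ : ∀ {xs ys} → xs ↭ ys → E xs ≡ E ys
  E-↭ refl = refl
  E-↭ (prep x p) = cong₂ _+_ (∑-↭ _ p) (E-↭ p)
  E-↭ {x ∷ y ∷ xs} {_ ∷ _ ∷ ys} (swap x y p)
    rewrite ∑-↭ (λ v → [ adj x v ]) p | ∑-↭ (λ v → [ adj y v ]) p | E-↭ p | adj-sym x y
    = interchange [ adj y x ] (D x ys) (D y ys) (E ys)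
  E-↭ (p then q) = trans (E-↭ p) (E-↭ q)

  D-self : ∀ x xs → D x (x ∷ xs) ≡ D x xs
  D-self x xs rewrite adj-irrefl x = refl

  D-flip : ∀ x xs → ∑ xs (λ v → [ adj v x ]) ≡ D x xs
  D-flip x [] = refl
  D-flip x (v ∷ xs) rewrite D-flip x xs | adj-sym v x = refl

  -- Both sides count an edge inside `xs` twice and every other edge once.
  E-++ : ∀ xs ys → E (xs ++ ys) + E xs ≡ ∑ xs (λ x → D x (xs ++ ys)) + E ys
  E-++ [] ys = +-comm (E ys) 0
  E-++ (x ∷ xs) ys
    rewrite D-self x (xs ++ ys) | ∑-+ xs (λ v → [ adj v x ]) (λ v → D v (xs ++ ys))
          | ∑-++ xs ys (λ v → [ adj x v ]) | D-flip x xs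
    = trans (lemma₁ (D x xs) (D x ys) (E (xs ++ ys)) (E xs))
        (trans (cong (D x xs + D x ys + D x xs +_) (E-++ xs ys))
          (lemma₂ (D x xs) (D x ys) (∑ xs (λ v → D v (xs ++ ys))) (E ys)))
    where
    lemma₁ : ∀ a b e i → a + b + e + (a + i) ≡ a + b + a + (e + i)
    lemma₁ = solve-∀
    lemma₂ : ∀ a b s e → a + b + a + (s + e) ≡ a + b + (a + s) + e
    lemma₂ = solve-∀

-- Graphs on six vertices with at most two edges missing

tri : ℕ → ℕ
tri zero = 0
tri (suc n) = n + tri n

missing : ∀ {n} → Vec Bool n → ℕ
missing [] = 0
missing (b ∷ bs) = [ not b ] + missing bs

-- Each branch to `false` spends one unit of `b`. For n = 15 and b = 2 this visits 1 + 15 + 105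
-- vectors rather than all 2^15, so the check can be evaluated during type checking.
few-missing? : ∀ n b {P : Vec Bool n → Set} → (∀ v → Dec (P v)) → Dec (∀ v → missing v ≤ b → P v)
few-missing? zero b P? = map′ (λ { p [] _ → p }) (λ f → f [] z≤n) (P? [])
few-missing? (suc n) zero P? = map′
  (λ { f (true ∷ v) m → f v m })
  (λ f v m → f (true ∷ v) m)
  (few-missing? n zero (P? ∘ (true ∷_)))
few-missing? (suc n) (suc b) P? = map′
  (λ { (f , g) (true ∷ v) m → f v m ; (f , g) (false ∷ v) m → g v (s≤s⁻¹ m) })
  (λ f → (λ v m → f (true ∷ v) m) , (λ v m → f (false ∷ v) (s≤s m)))
  (few-missing? n (suc b) (P? ∘ (true ∷_)) ×-dec few-missing? n b (P? ∘ (false ∷_)))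

-- The adjacency matrix whose strict upper triangle is read off row by row.
matrix : ∀ {n} → Vec Bool (tri n) → Fin n → Fin n → Bool
matrix {suc n} v zero zero = false
matrix {suc n} v zero (suc j) = Vec.lookup (Vec.take n v) j
matrix {suc n} v (suc i) zero = Vec.lookup (Vec.take n v) i
matrix {suc n} v (suc i) (suc j) = matrix (Vec.drop n v) i j

-- The inequalities concern the six pairs at distance at least three along the path; in a loopless
-- graph the other nine pairs are distinct because they are adjacent.
Copy : (Fin 6 → Fin 6 → Bool) → Vec (Fin 6) 6 → Set
Copy g (a ∷ b ∷ c ∷ d ∷ e ∷ f ∷ []) =
  (g a b ≡ true × g a c ≡ true × g b c ≡ true × g b d ≡ true × g c d ≡ true ×
   g c e ≡ true × g d e ≡ true × g d f ≡ true × g e f ≡ true) ×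
  (a ≢ d × a ≢ e × a ≢ f × b ≢ e × b ≢ f × c ≢ f)

copy? : ∀ g σ → Dec (Copy g σ)
copy? g (a ∷ b ∷ c ∷ d ∷ e ∷ f ∷ []) =
  (g a b =? true ×-dec g a c =? true ×-dec g b c =? true ×-dec g b d =? true ×-dec g c d =? true ×-dec
   g c e =? true ×-dec g d e =? true ×-dec g d f =? true ×-dec g e f =? true) ×-dec
  (a ≢? d ×-dec a ≢? e ×-dec a ≢? f ×-dec b ≢? e ×-dec b ≢? f ×-dec c ≢? f)
  where
  infix 4 _=?_ _≢?_
  _=?_ = Bool._≟_
  _≢?_ : (i j : Fin 6) → Dec (i ≢ j)
  i ≢? j = ¬? (i Fin.≟ j)

-- Any two edges of K₆ are avoided by one of these copies of the square of the path.
orders : List (Vec (Fin 6) 6)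
orders =
  (# 1 ∷ # 2 ∷ # 3 ∷ # 4 ∷ # 0 ∷ # 5 ∷ []) ∷
  (# 2 ∷ # 0 ∷ # 1 ∷ # 4 ∷ # 5 ∷ # 3 ∷ []) ∷
  (# 2 ∷ # 5 ∷ # 3 ∷ # 0 ∷ # 1 ∷ # 4 ∷ []) ∷
  (# 0 ∷ # 3 ∷ # 2 ∷ # 5 ∷ # 4 ∷ # 1 ∷ []) ∷
  (# 0 ∷ # 5 ∷ # 2 ∷ # 1 ∷ # 4 ∷ # 3 ∷ []) ∷
  (# 2 ∷ # 4 ∷ # 0 ∷ # 5 ∷ # 1 ∷ # 3 ∷ []) ∷
  (# 4 ∷ # 3 ∷ # 0 ∷ # 2 ∷ # 1 ∷ # 5 ∷ []) ∷
  (# 0 ∷ # 1 ∷ # 4 ∷ # 2 ∷ # 5 ∷ # 3 ∷ []) ∷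
  (# 2 ∷ # 4 ∷ # 1 ∷ # 3 ∷ # 0 ∷ # 5 ∷ []) ∷
  (# 3 ∷ # 1 ∷ # 0 ∷ # 5 ∷ # 2 ∷ # 4 ∷ []) ∷
  (# 0 ∷ # 2 ∷ # 3 ∷ # 1 ∷ # 5 ∷ # 4 ∷ []) ∷ []

copy-in-dense : ∀ (v : Vec Bool 15) → missing v ≤ 2 → Any (Copy (matrix v)) orders
copy-in-dense = from-yes (few-missing? 15 2 (λ v → any? (copy? (matrix v)) orders))

take-++ : ∀ {A : Set} {m n} (xs : Vec A m) (ys : Vec A n) → Vec.take m (xs Vec.++ ys) ≡ xs
take-++ [] ys = refl
take-++ (x ∷ xs) ys = cong (x ∷_) (take-++ xs ys)

drop-++ : ∀ {A : Set} {m n} (xs : Vec A m) (ys : Vec A n) → Vec.drop m (xs Vec.++ ys) ≡ ys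
drop-++ [] ys = refl
drop-++ (x ∷ xs) ys = drop-++ xs ys

missing-++ : ∀ {m n} (u : Vec Bool m) (v : Vec Bool n) → missing (u Vec.++ v) ≡ missing u + missing v
missing-++ [] v = refl
missing-++ (b ∷ u) v rewrite missing-++ u v = sym (+-assoc [ not b ] _ _)

unique-fromList : ∀ {A : Set} {xs : List A} → Unique xs → Uniqueᵛ (Vec.fromList xs)
unique-fromList [] = []
unique-fromList (x≢ ∷ uniq) = fromList⁺ x≢ ∷ unique-fromList uniq

-- Arithmetic of the reductions

true≢false : true ≢ false
true≢false ()

-- The two pairs share `u` and so count it twice; the surplus is at least `p`. The 3 is the number
-- of edges of the triangle, which the degree sum counts twice.
triangle-arith : ∀ {e r n p u c d} → e + 3 ≡ u + (c + (d + 0)) + r →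
  u + c ≤ n + 1 → u + d ≤ n + 1 → p ≤ u → e + (3 + p) ≤ 2 * (n + 1) + r
triangle-arith {e} {r} {n} {p} {u} {c} {d} eq uc ud p≤u = begin
  e + (3 + p)                ≡⟨ +-assoc e 3 p ⟨
  e + 3 + p                  ≡⟨ cong (_+ p) eq ⟩
  u + (c + (d + 0)) + r + p  ≤⟨ +-monoʳ-≤ _ p≤u ⟩
  u + (c + (d + 0)) + r + u  ≡⟨ regroup u c d r ⟩
  u + c + (u + d) + r        ≤⟨ +-monoˡ-≤ r (+-mono-≤ uc ud) ⟩
  n + 1 + (n + 1) + r        ≡⟨ double n r ⟩
  2 * (n + 1) + r            ∎
  where
  open ≤-Reasoning
  regroup : ∀ u c d r → u + (c + (d + 0)) + r + u ≡ u + c + (u + d) + r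
  regroup = solve-∀
  double : ∀ n r → n + 1 + (n + 1) + r ≡ 2 * (n + 1) + r
  double = solve-∀

-- Three pairs cover the five vertices of K₅ minus an edge, with `u` twice, which saves `p`. Of the
-- 9 inner edges, 6 are used up by the three bounds n + 2, and 3 remain.
diamond-arith : ∀ {e r n p a b c d u} → e + 9 ≡ a + (b + (c + (d + (u + 0)))) + r →
  u + b ≤ n + 2 → a + c ≤ n + 2 → u + d ≤ n + 2 → p ≤ u → e + (3 + p) ≤ 3 * n + r
diamond-arith {e} {r} {n} {p} {a} {b} {c} {d} {u} eq ub ac ud p≤u = +-cancelʳ-≤ 6 _ _ (begin
  e + (3 + p) + 6                         ≡⟨ shuffle e p ⟩
  e + 9 + p                               ≡⟨ cong (_+ p) eq ⟩
  a + (b + (c + (d + (u + 0)))) + r + p   ≤⟨ +-monoʳ-≤ _ p≤u ⟩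
  a + (b + (c + (d + (u + 0)))) + r + u   ≡⟨ regroup a b c d u r ⟩
  u + b + (a + c) + (u + d) + r           ≤⟨ +-monoˡ-≤ r (+-mono-≤ (+-mono-≤ ub ac) ud) ⟩
  n + 2 + (n + 2) + (n + 2) + r           ≡⟨ triple n r ⟩
  3 * n + r + 6                           ∎)
  where
  open ≤-Reasoning
  shuffle : ∀ e p → e + (3 + p) + 6 ≡ e + 9 + p
  shuffle = solve-∀
  regroup : ∀ a b c d u r → a + (b + (c + (d + (u + 0)))) + r + u ≡ u + b + (a + c) + (u + d) + r
  regroup = solve-∀
  triple : ∀ n r → n + 2 + (n + 2) + (n + 2) + r ≡ 3 * n + r + 6
  triple = solve-∀

-- A K₅ meets at most n + 5 edges. Given `p + 9 ≤ 2 * n`, this fits into the loss 3n - 3 - p allowed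
-- for K₅ minus an edge, so that both share one kind of deletion.
K₅-arith : ∀ {e r n p s} → e + 10 ≡ s + r → s ≤ n + 15 → p + 9 ≤ 2 * n →
  e + (3 + p) ≤ 3 * n + r
K₅-arith {e} {r} {n} {p} {s} eq s≤ p≤ = +-cancelʳ-≤ 16 _ _ (begin
  e + (3 + p) + 16         ≡⟨ shuffle e p ⟩
  e + 10 + (p + 9)         ≡⟨ cong (_+ (p + 9)) eq ⟩
  s + r + (p + 9)          ≤⟨ +-mono-≤ (+-monoˡ-≤ r s≤) p≤ ⟩
  n + 15 + r + 2 * n       ≡⟨ regroup n r ⟩
  3 * n + r + 15           ≤⟨ +-monoʳ-≤ (3 * n + r) (n≤1+n 15) ⟩
  3 * n + r + 16           ∎)
  where
  open ≤-Reasoning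
  shuffle : ∀ e p → e + (3 + p) + 16 ≡ e + 10 + (p + 9)
  shuffle = solve-∀
  regroup : ∀ n r → n + 15 + r + 2 * n ≡ 3 * n + r + 15
  regroup = solve-∀

square-arith : ∀ {e r n a b c d} → e + 4 ≡ a + (b + (c + (d + 0))) + r →
  a + b ≤ n + 1 → c + d ≤ n + 1 → e + 4 ≤ 2 * (n + 1) + r
square-arith {e} {r} {n} {a} {b} {c} {d} eq ab cd = begin
  e + 4                            ≡⟨ eq ⟩
  a + (b + (c + (d + 0))) + r      ≡⟨ regroup a b c d r ⟩
  a + b + (c + d) + r              ≤⟨ +-monoˡ-≤ r (+-mono-≤ ab cd) ⟩
  n + 1 + (n + 1) + r              ≡⟨ double n r ⟩
  2 * (n + 1) + r                  ∎
  where
  open ≤-Reasoning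
  regroup : ∀ a b c d r → a + (b + (c + (d + 0))) + r ≡ a + b + (c + d) + r
  regroup = solve-∀
  double : ∀ n r → n + 1 + (n + 1) + r ≡ 2 * (n + 1) + r
  double = solve-∀

-- The estimate passes through 2(n + 1) > n + 8, which is where n ≥ 7 comes from.
n+8<4p : ∀ n p → n + 1 ≤ p + p → 7 ≤ n → n + 8 < 4 * p
n+8<4p n p n<2p 7≤n = begin-strict
  n + 8              <⟨ +-monoʳ-< n (+-monoˡ-≤ 2 7≤n) ⟩
  n + (n + 2)        ≡⟨ double n ⟩
  2 * (n + 1)        ≤⟨ *-monoʳ-≤ 2 n<2p ⟩
  2 * (p + p)        ≡⟨ quadruple p ⟩
  4 * p              ∎
  where
  open ≤-Reasoning
  double : ∀ n → n + (n + 2) ≡ 2 * (n + 1)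
  double = solve-∀
  quadruple : ∀ p → 2 * (p + p) ≡ 4 * p
  quadruple = solve-∀

n+15<5p : ∀ n p → n + 3 ≤ p + p → 7 ≤ n → n + 15 < 5 * p
n+15<5p n p n≤ 7≤n = *-cancelˡ-< 2 _ _ (begin-strict
  2 * (n + 15)            ≡⟨ lemma₁ n ⟩
  2 * n + 15 + 15         <⟨ +-monoʳ-< (2 * n + 15) (≤-trans (≤ᵇ⇒≤ 16 21 _) (*-monoʳ-≤ 3 7≤n)) ⟩
  2 * n + 15 + 3 * n      ≡⟨ lemma₂ n ⟩
  5 * (n + 3)             ≤⟨ *-monoʳ-≤ 5 n≤ ⟩
  5 * (p + p)             ≡⟨ lemma₃ p ⟩
  2 * (5 * p)             ∎)
  where
  open ≤-Reasoning
  lemma₁ : ∀ n → 2 * (n + 15) ≡ 2 * n + 15 + 15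
  lemma₁ = solve-∀
  lemma₂ : ∀ n → 2 * n + 15 + 3 * n ≡ 5 * (n + 3)
  lemma₂ = solve-∀
  lemma₃ : ∀ p → 5 * (p + p) ≡ 2 * (5 * p)
  lemma₃ = solve-∀

-- exᵣ k = exP6 (6k + r)
ex₁ ex₂ ex₃ ex₄ ex₅ ex₆ : ℕ → ℕ
ex₁ k = 9 * (k * k) + 6 * k
ex₂ k = 9 * (k * k) + 9 * k + 1
ex₃ k = 9 * (k * k) + 12 * k + 3
ex₄ k = 9 * (k * k) + 15 * k + 6
ex₅ k = 9 * (k * k) + 18 * k + 9
ex₆ k = 9 * (k * k) + 21 * k + 12

≡+⇒≤ : ∀ {m n o} → n ≡ m + o → m ≤ n
≡+⇒≤ {m} {o = o} eq = ≤-trans (m≤m+n m o) (≤-reflexive (sym eq))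

-- Graphs without the square of a path on six vertices

module Square-path-free {A : Set} (_≟_ : DecidableEquality A) (adj : A → A → Bool)
  (adj-sym : ∀ x y → adj x y ≡ adj y x) (adj-irrefl : ∀ x → adj x x ≡ false)
  (no-P²₆ : ∀ {a b c d e f} →
    adj a b ≡ true → adj a c ≡ true → adj b c ≡ true → adj b d ≡ true → adj c d ≡ true →
    adj c e ≡ true → adj d e ≡ true → adj d f ≡ true → adj e f ≡ true →
    a ≢ d → a ≢ e → a ≢ f → b ≢ e → b ≢ f → c ≢ f → ⊥) where

  open Occurrences _≟_
  open EdgeCount adj adj-sym adj-irrefl

  infix 4 _~_ _≁_
  _~_ _≁_ : A → A → Set
  x ~ y = adj x y ≡ true
  x ≁ y = adj x y ≡ false

  ~-sym : ∀ {x y} → x ~ y → y ~ x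
  ~-sym {x} {y} x~y = trans (adj-sym y x) x~y

  ≁-sym : ∀ {x y} → x ≁ y → y ≁ x
  ≁-sym {x} {y} x≁y = trans (adj-sym y x) x≁y

  ~⇒≢ : ∀ {x y} → x ~ y → x ≢ y
  ~⇒≢ {x} x~x refl = true≢false (trans (sym x~x) (adj-irrefl x))

  ~∧≁⇒≢ : ∀ {x y z} → x ~ y → x ≁ z → y ≢ z
  ~∧≁⇒≢ x~y x≁y refl = true≢false (trans (sym x~y) x≁y)

  neighbour : ∀ K {u} → 1 ≤ ∑ K (λ x → [ adj x u ]) → ∃[ c ] ∃[ R ] K ↭ c ∷ R × c ~ u
  neighbour (x ∷ K) {u} 1≤ with adj x u in x?u
  ... | true = x , K , ↭-refl , x?u
  ... | false = let c , R , K↭ , c~u = neighbour K 1≤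
                in c , x ∷ R , ↭-trans (prep x K↭) (swap x c ↭-refl) , c~u

  -- The result is a permutation so that a clique can be reordered with the two neighbours in front.
  two-neighbours : ∀ K {u} → 2 ≤ ∑ K (λ x → [ adj x u ]) →
    ∃[ c ] ∃[ d ] ∃[ R ] K ↭ c ∷ d ∷ R × c ~ u × d ~ u
  two-neighbours K {u} 2≤ =
    let c , R , K↭ , c~u = neighbour K (<⇒≤ 2≤)
        d , R′ , R↭ , d~u = neighbour R
          (s≤s⁻¹ (subst (2 ≤_) (trans (∑-↭ _ K↭) (cong (λ b → [ b ] + ∑ R (λ x → [ adj x u ])) c~u)) 2≤))
    in c , d , R′ , ↭-trans K↭ (prep c R↭) , c~u , d~u

  Clique : List A → Set
  Clique = AllPairs _~_

  clique-↭ : ∀ {K L} → K ↭ L → Clique K → Clique L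
  clique-↭ K↭L = AllPairs-resp-↭ (setoid A) ~-sym (subst (_ ~_) , subst (_~ _)) (↭⇒↭ₛ K↭L)

  clique-unique : ∀ {K} → Clique K → Unique K
  clique-unique = AllPairs.map ~⇒≢

  degree-within : ∀ {v K} → v ∈ K → ∑ K (λ x → [ adj x v ]) < length K
  degree-within {v} {_ ∷ K} (here refl) rewrite adj-irrefl v = s≤s (≤-length K)
    where
    ≤-length : ∀ L → ∑ L (λ x → [ adj x v ]) ≤ length L
    ≤-length [] = z≤n
    ≤-length (x ∷ L) with adj x v
    ... | true = s≤s (≤-length L)
    ... | false = m≤n⇒m≤1+n (≤-length L)
  degree-within {v} {x ∷ K} (there v∈) with adj x v
  ... | true = s≤s (degree-within v∈)
  ... | false = m≤n⇒m≤1+n (degree-within v∈)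

  -- In path order the copy is a, b, c, d, u, w. Every order of a K₄ that ends in two neighbours of
  -- `u` may be used, which gives degree bounds for several pairs.
  clique-end : ∀ {a b c d u w} → Clique (a ∷ b ∷ c ∷ d ∷ []) → c ~ u → d ~ u →
    u ~ w → d ~ w → a ≢ u → b ≢ u → a ≢ w → b ≢ w → c ≢ w → ⊥
  clique-end ((ab ∷ ac ∷ ad ∷ []) ∷ (bc ∷ bd ∷ []) ∷ (cd ∷ []) ∷ [] ∷ []) cu du uw dw a≢u b≢u a≢w b≢w c≢w =
    no-P²₆ ab ac bc bd cd cu du dw uw (~⇒≢ ad) a≢u a≢w b≢u b≢w c≢w

  -- Counting degrees and common neighbours in an induced subgraph

  module _ {S : List A} (S-unique : Unique S) where

    -- A vertex contributes at most 2 to the two degrees. A listed vertex is allowed at least 2 and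
    -- any other vertex 1, so only an unlisted common neighbour can exceed its allowance.
    common-neighbour : ∀ a b ex → length S + length ex < D a S + D b S →
      ∃[ v ] v ∈ S × a ~ v × b ~ v × All (v ≢_) ex
    common-neighbour a b ex lt
      with weighted-pigeonhole S-unique ex 1 (λ v → [ adj a v ] + [ adj b v ])
             (subst (length S + 1 * length ex <_) (sym (∑-+ S _ _))
               (subst (λ l → length S + l < _) (sym (*-identityˡ (length ex))) lt))
    ... | v , v∈S , lt′ with adj a v in a?v | adj b v in b?v
    ... | true | true = v , v∈S , a?v , b?v ,
          occ≡0⇒≢ ex (trans (sym (*-identityˡ (occ ex v))) (n≤0⇒n≡0 (s≤s⁻¹ (s≤s⁻¹ lt′))))
    ... | true | false = ⊥-elim (n≮0 (s≤s⁻¹ lt′))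
    ... | false | true = ⊥-elim (n≮0 (s≤s⁻¹ lt′))
    ... | false | false = ⊥-elim (n≮0 lt′)

    common-neighbour′ : ∀ a b ex {p q} → length S + suc (length ex) ≤ p + q → p ≤ D a S → q ≤ D b S →
      ∃[ v ] v ∈ S × a ~ v × b ~ v × All (v ≢_) ex
    common-neighbour′ a b ex n≤ p≤ q≤ = common-neighbour a b ex
      (≤-trans (≤-trans (≤-reflexive (sym (+-suc (length S) _))) n≤) (+-mono-≤ p≤ q≤))

    -- If `c` is the only possible common neighbour, a degree sum of n + 1 leaves no vertex of `S`
    -- uncovered. The extra weight on `d` forces the excess in the count to occur at `d` itself.
    neighbourhoods-cover : ∀ {a b c d} → length S + 1 ≤ D a S + D b S →
      (∀ {w} → a ~ w → b ~ w → All (w ≢_) (c ∷ []) → ⊥) → d ∈ S → b ≁ d → a ~ d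
    neighbourhoods-cover {a} {b} {c} {d} n≤ none d∈S b≁d
      with weighted-pigeonhole S-unique (c ∷ []) 1 (λ v → [ adj a v ] + [ adj b v ] + [ does (v ≟ d) ])
             (subst (length S + 1 <_) (sym total)
               (≤-trans (≤-reflexive (+-comm 1 (length S + 1))) (+-mono-≤ n≤ (1≤∑-≟ d∈S))))
      where
      total : ∑ S (λ v → [ adj a v ] + [ adj b v ] + [ does (v ≟ d) ]) ≡
        D a S + D b S + ∑ S (λ v → [ does (v ≟ d) ])
      total = trans (∑-+ S _ _) (cong (_+ ∑ S (λ v → [ does (v ≟ d) ])) (∑-+ S _ _))
    ... | v , v∈S , lt with v ≟ d | v ≟ c | adj a v in a?v | adj b v in b?v
    ... | yes refl | _ | true | _ = a?v
    ... | yes refl | _ | false | true = ⊥-elim (true≢false (trans (sym b?v) b≁d))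
    ... | yes refl | yes _ | false | false = ⊥-elim (n≮0 (s≤s⁻¹ lt))
    ... | yes refl | no _ | false | false = ⊥-elim (n≮0 (s≤s⁻¹ lt))
    ... | no _ | yes _ | true | true = ⊥-elim (n≮0 (s≤s⁻¹ (s≤s⁻¹ lt)))
    ... | no _ | no v≢c | true | true = ⊥-elim (none a?v b?v (v≢c ∷ []))
    ... | no _ | _ | true | false = ⊥-elim (n≮0 (s≤s⁻¹ lt))
    ... | no _ | _ | false | true = ⊥-elim (n≮0 (s≤s⁻¹ lt))
    ... | no _ | _ | false | false = ⊥-elim (n≮0 lt)

    codegree-≤ : ∀ a b ex → (∀ {v} → a ~ v → b ~ v → All (v ≢_) ex → ⊥) →
      D a S + D b S ≤ length S + length ex
    codegree-≤ a b ex none = ≮⇒≥ λ lt →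
      let v , _ , a~v , b~v , v∉ = common-neighbour a b ex lt in none a~v b~v v∉

    -- Every vertex v gets the allowance 1 + (|K| − 2)·[v ∈ K], which a vertex of K itself cannot exceed.
    outside-vertex : ∀ x y K → length S + length K * length (x ∷ y ∷ K) < ∑ (x ∷ y ∷ K) (λ z → D z S) →
      ∃[ v ] v ∈ S × All (v ≢_) (x ∷ y ∷ K) × 2 ≤ ∑ (x ∷ y ∷ K) (λ z → [ adj z v ])
    outside-vertex x y K lt
      with weighted-pigeonhole S-unique (x ∷ y ∷ K) (length K) (λ v → ∑ (x ∷ y ∷ K) (λ z → [ adj z v ]))
             (subst (_ <_) (∑-swap (x ∷ y ∷ K) S (λ z v → [ adj z v ])) lt)
    ... | v , v∈S , lt′ with occ (x ∷ y ∷ K) v in eq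
    ... | zero = v , v∈S , occ≡0⇒≢ (x ∷ y ∷ K) eq , ≤-trans (s≤s (s≤s z≤n)) lt′
    ... | suc o = ⊥-elim (1+n≰n (begin
          3 + length K                            ≤⟨ s≤s (s≤s (s≤s (m≤m*n (length K) (suc o)))) ⟩
          3 + length K * suc o                    ≤⟨ s≤s lt′ ⟩
          suc (∑ (x ∷ y ∷ K) (λ z → [ adj z v ])) ≤⟨ degree-within (occurs (x ∷ y ∷ K) eq) ⟩
          2 + length K                            ∎))
      where
      open ≤-Reasoning
      occurs : ∀ L {o} → occ L v ≡ suc o → v ∈ L
      occurs (z ∷ L) eq with v ≟ z
      ... | yes refl = here refl
      ... | no _ = there (occurs L eq)

    remove : ∀ {xs} → Unique xs → All (_∈ S) xs →
      ∃[ R ] Unique R × length S ≡ length xs + length R ×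
        E S + E xs ≡ ∑ xs (λ x → D x S) + E R
    remove {xs} uniq xs⊆S with extract uniq xs⊆S
    ... | R , S↭ = R , unique-++ʳ xs (unique-↭ S↭ S-unique)
          , trans (↭-length S↭) (length-++ xs)
          , trans (cong (_+ E xs) (E-↭ S↭)) (trans (E-++ xs R)
              (cong (_+ E R) (∑-cong xs (λ x → sym (∑-↭ (λ v → [ adj x v ]) S↭)))))

    -- A vertex outside with two neighbours in the K₅ completes a copy: the three other clique
    -- vertices, those two, then the vertex itself. So the sum is at most (n - 5) + 5 · 4.
    K₅-degrees : ∀ {a b c d e} → Clique (a ∷ b ∷ c ∷ d ∷ e ∷ []) →
      ∑ (a ∷ b ∷ c ∷ d ∷ e ∷ []) (λ x → D x S) ≤ length S + 15
    K₅-degrees {a} {b} {c} {d} {e} K = ≮⇒≥ λ lt →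
      let v , _ , v∉K , 2≤ = outside-vertex a b (c ∷ d ∷ e ∷ []) lt
          x , y , R , K↭ , x~v , y~v = two-neighbours (a ∷ b ∷ c ∷ d ∷ e ∷ []) 2≤
      in extend R (sym (↭-length K↭)) (clique-↭ K↭ K) (All-resp-↭ K↭ v∉K) x~v y~v
      where
      extend : ∀ R {v x y} → 2 + length R ≡ 5 → Clique (x ∷ y ∷ R) → All (v ≢_) (x ∷ y ∷ R) →
        x ~ v → y ~ v → ⊥
      extend (p ∷ q ∷ r ∷ []) refl
        ((xy ∷ xp ∷ xq ∷ xr ∷ []) ∷ (yp ∷ yq ∷ yr ∷ []) ∷ (pq ∷ pr ∷ []) ∷ (qr ∷ []) ∷ [] ∷ [])
        (_ ∷ _ ∷ v≢p ∷ v≢q ∷ v≢r ∷ []) xv yv =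
        no-P²₆ pq pr qr (~-sym xq) (~-sym xr) (~-sym yr) xy xv yv
          (~⇒≢ (~-sym xp)) (~⇒≢ (~-sym yp)) (v≢p ∘ sym) (~⇒≢ (~-sym yq)) (v≢q ∘ sym) (v≢r ∘ sym)

    Deletion : ℕ → ℕ → ℕ → Set
    Deletion j x y = ∃[ R ] Unique R × length S ≡ j + length R × E S + x ≤ y + E R

    -- The inequality carried by `delete-4` and `delete-3` records that some pair has degree sum at
    -- most n + 1; it excludes both outcomes when 2p ≥ n + 2.
    data Reduction (p : ℕ) : Set where
      delete-5 : Deletion 5 (3 + p) (3 * length S) → Reduction p
      delete-4 : p + p ≤ length S + 1 → Deletion 4 4 (2 * (length S + 1)) → Reduction p
      delete-3 : p + p ≤ length S + 1 → Deletion 3 (3 + p) (2 * (length S + 1)) → Reduction p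

    -- The five vertices span K₅ minus the edge `a`, `u`. A common neighbour of `u` and `d` other
    -- than `b` and `c` differs from `a`, as `a ≁ u`, and so completes `clique-end`.
    apex-degrees : ∀ {a b c d u} → Clique (a ∷ b ∷ c ∷ d ∷ []) → a ≁ u → a ≢ u →
      b ~ u → c ~ u → d ~ u → D u S + D d S ≤ length S + 2
    apex-degrees {a} {b} {c} {d} {u} K au a≢u bu cu du = codegree-≤ u d (b ∷ c ∷ []) λ
      { uw dw (w≢b ∷ w≢c ∷ []) → clique-end K cu du uw dw a≢u (~⇒≢ bu)
          (~∧≁⇒≢ uw (≁-sym au) ∘ sym) (w≢b ∘ sym) (w≢c ∘ sym) }

    -- In path order the copy is a, b, h, c, d, w. The two non-edges keep `w` apart from `a` and
    -- `b`, and `a` apart from `d`.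
    link-path-end : ∀ {h a b c d} → h ~ a → h ~ b → h ~ c → h ~ d → a ~ b → b ~ c → c ~ d →
      a ≁ c → b ≁ d → a ≢ c → b ≢ d → ∀ {w} → c ~ w → d ~ w → All (w ≢_) (h ∷ []) → ⊥
    link-path-end ha hb hc hd ab bc cd ac bd a≢c b≢d cw dw (w≢h ∷ []) =
      no-P²₆ ab (~-sym ha) (~-sym hb) bc hc hd cd cw dw a≢c (~∧≁⇒≢ cd (≁-sym ac) ∘ sym)
        (~∧≁⇒≢ cw (≁-sym ac) ∘ sym) b≢d (~∧≁⇒≢ dw (≁-sym bd) ∘ sym) (w≢h ∘ sym)

    -- Reductions under a minimum degree assumption

    module _ {p : ℕ} (min-degree : ∀ {v} → v ∈ S → p ≤ D v S) where

      min-degrees : ∀ {xs} → All (_∈ S) xs → length xs * p ≤ ∑ xs (λ x → D x S)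
      min-degrees xs⊆S = ∑-lower (All.map (λ x∈S → min-degree x∈S) xs⊆S)

      delete-K₅⁻ : ∀ {a b c d u} → Clique (a ∷ b ∷ c ∷ d ∷ []) → All (_∈ S) (a ∷ b ∷ c ∷ d ∷ []) →
        u ∈ S → a ≁ u → a ≢ u → b ~ u → c ~ u → d ~ u → Deletion 5 (3 + p) (3 * length S)
      delete-K₅⁻ {a} {b} {c} {d} {u}
        K@((ab ∷ ac ∷ ad ∷ []) ∷ (bc ∷ bd ∷ []) ∷ (cd ∷ []) ∷ [] ∷ [])
        (a∈ ∷ b∈ ∷ c∈ ∷ d∈ ∷ []) u∈ au a≢u bu cu du =
        let R , uniq , len , eq = remove
              ((~⇒≢ ab ∷ ~⇒≢ ac ∷ ~⇒≢ ad ∷ a≢u ∷ []) ∷ (~⇒≢ bc ∷ ~⇒≢ bd ∷ ~⇒≢ bu ∷ []) ∷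
               (~⇒≢ cd ∷ ~⇒≢ cu ∷ []) ∷ (~⇒≢ du ∷ []) ∷ [] ∷ [])
              (a∈ ∷ b∈ ∷ c∈ ∷ d∈ ∷ u∈ ∷ [])
        in R , uniq , len , diamond-arith {a = D a S} {b = D b S} {c = D c S} {d = D d S} {u = D u S}
             (trans (cong (E S +_) (sym inner)) eq)
             (apex-degrees (clique-↭ (prep a (swap b c ↭-refl then prep c (swap b d ↭-refl))) K)
               au a≢u cu du bu)
             -- K₅ minus an edge is symmetric in its two non-adjacent vertices; exchanging `a` and
             -- `u` bounds the pair `a`, `c`.
             (apex-degrees ((~-sym bu ∷ ~-sym du ∷ ~-sym cu ∷ []) ∷ (bd ∷ bc ∷ []) ∷ (~-sym cd ∷ []) ∷ [] ∷ [])
               (≁-sym au) (a≢u ∘ sym) (~-sym ab) (~-sym ad) (~-sym ac))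
             (apex-degrees K au a≢u bu cu du)
             (min-degree u∈)
        where
        inner : E (a ∷ b ∷ c ∷ d ∷ u ∷ []) ≡ 9
        inner rewrite ab | ac | ad | au | bc | bd | bu | cd | cu | du = refl

      -- Depending on how many of `a` and `b` are adjacent to `u`, there is a K₅, a K₅ minus an
      -- edge, or the triangle u, c, d. In the last case a common neighbour of `u` with `c` or `d`
      -- outside the triangle is neither `a` nor `b`, hence ends a copy.
      attached : p + 9 ≤ 2 * length S → ∀ {a b c d u} → Clique (c ∷ d ∷ a ∷ b ∷ []) →
        All (_∈ S) (c ∷ d ∷ a ∷ b ∷ []) → u ∈ S → All (u ≢_) (c ∷ d ∷ a ∷ b ∷ []) → c ~ u → d ~ u →
        Reduction p
      attached p≤ {a} {b} {c} {d} {u}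
        K@((cd ∷ ca ∷ cb ∷ []) ∷ (da ∷ db ∷ []) ∷ (ab ∷ []) ∷ [] ∷ [])
        K⊆S@(c∈ ∷ d∈ ∷ a∈ ∷ b∈ ∷ []) u∈ (u≢c ∷ u≢d ∷ u≢a ∷ u≢b ∷ []) cu du
        with adj a u in au | adj b u in bu
      ... | true | true =
        let uc = ~-sym cu ; ud = ~-sym du ; ua = ~-sym au ; ub = ~-sym bu
            L = (uc ∷ ud ∷ ua ∷ ub ∷ []) ∷ K
            R , uniq , len , eq = remove (clique-unique L) (u∈ ∷ K⊆S)
        in delete-5 (R , uniq , len ,
             K₅-arith {n = length S} (trans (cong (E S +_) (sym (inner uc ud ua ub))) eq) (K₅-degrees L) p≤)
        where
        inner : u ~ c → u ~ d → u ~ a → u ~ b → E (u ∷ c ∷ d ∷ a ∷ b ∷ []) ≡ 10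
        inner uc ud ua ub rewrite uc | ud | ua | ub | cd | ca | cb | da | db | ab = refl
      ... | true | false = delete-5 (delete-K₅⁻
        ((~-sym cb ∷ ~-sym db ∷ ~-sym ab ∷ []) ∷ (cd ∷ ca ∷ []) ∷ (da ∷ []) ∷ [] ∷ [])
        (b∈ ∷ c∈ ∷ d∈ ∷ a∈ ∷ []) u∈ bu (u≢b ∘ sym) cu du au)
      ... | false | true = delete-5 (delete-K₅⁻
        ((~-sym ca ∷ ~-sym da ∷ ab ∷ []) ∷ (cd ∷ cb ∷ []) ∷ (db ∷ []) ∷ [] ∷ [])
        (a∈ ∷ c∈ ∷ d∈ ∷ b∈ ∷ []) u∈ au (u≢a ∘ sym) cu du bu)
      ... | false | false =
        let R , uniq , len , eq = remove
              ((u≢c ∷ u≢d ∷ []) ∷ (~⇒≢ cd ∷ []) ∷ [] ∷ []) (u∈ ∷ c∈ ∷ d∈ ∷ [])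
        in delete-3 (≤-trans (+-mono-≤ (min-degree u∈) (min-degree c∈)) u+c)
             (R , uniq , len , triangle-arith {u = D u S} {c = D c S} {d = D d S}
               (trans (cong (E S +_) (sym (inner (~-sym cu) (~-sym du)))) eq) u+c u+d (min-degree u∈))
        where
        inner : u ~ c → u ~ d → E (u ∷ c ∷ d ∷ []) ≡ 3
        inner uc ud rewrite uc | ud | cd = refl
        u+c : D u S + D c S ≤ length S + 1
        u+c = codegree-≤ u c (d ∷ []) λ
          { uw cw (w≢d ∷ []) → clique-end
              ((ab ∷ ~-sym da ∷ ~-sym ca ∷ []) ∷ (~-sym db ∷ ~-sym cb ∷ []) ∷ (~-sym cd ∷ []) ∷ [] ∷ [])
              du cu uw cw (u≢a ∘ sym) (u≢b ∘ sym)
              (~∧≁⇒≢ uw (≁-sym au) ∘ sym) (~∧≁⇒≢ uw (≁-sym bu) ∘ sym) (w≢d ∘ sym) }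
        u+d : D u S + D d S ≤ length S + 1
        u+d = codegree-≤ u d (c ∷ []) λ
          { uw dw (w≢c ∷ []) → clique-end
              ((ab ∷ ~-sym ca ∷ ~-sym da ∷ []) ∷ (~-sym cb ∷ ~-sym db ∷ []) ∷ (cd ∷ []) ∷ [] ∷ [])
              cu du uw dw (u≢a ∘ sym) (u≢b ∘ sym)
              (~∧≁⇒≢ uw (≁-sym au) ∘ sym) (~∧≁⇒≢ uw (≁-sym bu) ∘ sym) (w≢c ∘ sym) }

      -- If every outside vertex had at most one neighbour in the K₄, its degrees would sum to at
      -- most (n - 4) + 4 · 3 = n + 8.
      reduce-K₄ : p + 9 ≤ 2 * length S → length S + 8 < 4 * p → ∀ {a b c d} →
        Clique (a ∷ b ∷ c ∷ d ∷ []) → All (_∈ S) (a ∷ b ∷ c ∷ d ∷ []) → Reduction p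
      reduce-K₄ p≤ <4p {a} {b} {c} {d} K K⊆S
        with outside-vertex a b (c ∷ d ∷ []) (<-≤-trans <4p (min-degrees K⊆S))
      ... | v , v∈S , v∉K , 2≤ with two-neighbours (a ∷ b ∷ c ∷ d ∷ []) 2≤
      ... | x , y , R , K↭ , x~v , y~v =
        finish R (sym (↭-length K↭)) (clique-↭ K↭ K) (All-resp-↭ K↭ K⊆S) v∈S (All-resp-↭ K↭ v∉K) x~v y~v
        where
        finish : ∀ R {v x y} → 2 + length R ≡ 4 → Clique (x ∷ y ∷ R) → All (_∈ S) (x ∷ y ∷ R) → v ∈ S →
          All (v ≢_) (x ∷ y ∷ R) → x ~ v → y ~ v → Reduction p
        finish (_ ∷ _ ∷ []) refl = attached p≤

      many-common : length S + 3 ≤ p + p → ∀ {x y} → x ∈ S → y ∈ S → ∀ ex {_ : length ex ≤ 2} →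
        ∃[ v ] v ∈ S × x ~ v × y ~ v × All (v ≢_) ex
      many-common n≤ {x} {y} x∈ y∈ ex {l≤2} = common-neighbour′ x y ex
        (≤-trans (+-monoʳ-≤ (length S) (s≤s l≤2)) n≤) (min-degree x∈) (min-degree y∈)

      min-degree-not-high : length S + 3 ≤ p + p → 7 ≤ length S → (∃[ v ] v ∈ S) → ⊥
      min-degree-not-high n≤ 7≤n (a , a∈)
        with many-common n≤ a∈ a∈ [] {z≤n}
      ... | b , b∈ , ab , _ , _
        with many-common n≤ a∈ b∈ [] {z≤n}
      ... | c , c∈ , ac , bc , _
        with many-common n≤ b∈ c∈ (a ∷ []) {s≤s z≤n}
      ... | d , d∈ , bd , cd , (d≢a ∷ [])
        with many-common n≤ c∈ d∈ (a ∷ b ∷ []) {s≤s (s≤s z≤n)}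
      ... | e , e∈ , ce , de , (e≢a ∷ e≢b ∷ [])
        -- Only two vertices can be avoided at a time. With no copy present, `f`, which avoids `b`
        -- and `c`, must be `a`, and `g`, which avoids `a` and `c`, must be `b`; this supplies the
        -- missing edges of a K₅.
        with many-common n≤ d∈ e∈ (b ∷ c ∷ []) {s≤s (s≤s z≤n)}
           | many-common n≤ d∈ e∈ (a ∷ c ∷ []) {s≤s (s≤s z≤n)}
      ... | f , _ , df , ef , (f≢b ∷ f≢c ∷ []) | g , _ , dg , eg , (g≢a ∷ g≢c ∷ []) =
        1+n≰n (<-≤-trans (n+15<5p _ p n≤ 7≤n)
          (≤-trans (min-degrees (a∈ ∷ b∈ ∷ c∈ ∷ d∈ ∷ e∈ ∷ [])) (K₅-degrees K)))
        where
        none : ∀ {w} → d ~ w → e ~ w → w ≢ a → w ≢ b → w ≢ c → ⊥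
        none dw ew w≢a w≢b w≢c = no-P²₆ ab ac bc bd cd ce de dw ew
          (d≢a ∘ sym) (e≢a ∘ sym) (w≢a ∘ sym) (e≢b ∘ sym) (w≢b ∘ sym) (w≢c ∘ sym)
        f≡a : f ≡ a
        f≡a = decidable-stable (f ≟ a) λ f≢a → none df ef f≢a f≢b f≢c
        g≡b : g ≡ b
        g≡b = decidable-stable (g ≟ b) λ g≢b → none dg eg g≢a g≢b g≢c
        K : Clique (a ∷ b ∷ c ∷ d ∷ e ∷ [])
        K = (ab ∷ ac ∷ ~-sym (subst (d ~_) f≡a df) ∷ ~-sym (subst (e ~_) f≡a ef) ∷ []) ∷
            (bc ∷ bd ∷ ~-sym (subst (e ~_) g≡b eg) ∷ []) ∷ (cd ∷ ce ∷ []) ∷ (de ∷ []) ∷ [] ∷ []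

      delete-C₄ : length S + 1 ≤ p + p → ∀ {h a b c d} → h ~ a → h ~ b → h ~ c → h ~ d →
        a ~ b → b ~ c → c ~ d → a ≁ c → b ≁ d → a ≢ c → b ≢ d → All (_∈ S) (a ∷ b ∷ c ∷ d ∷ []) → Reduction p
      delete-C₄ n<2p {h} {a} {b} {c} {d} ha hb hc hd ab bc cd ac bd a≢c b≢d abcd⊆S@(a∈ ∷ b∈ ∷ c∈ ∷ d∈ ∷ []) =
        let R , uniq , len , eq = remove
              ((~⇒≢ ab ∷ a≢c ∷ ~⇒≢ ad ∷ []) ∷ (~⇒≢ bc ∷ b≢d ∷ []) ∷ (~⇒≢ cd ∷ []) ∷ [] ∷ []) abcd⊆S
        in delete-4 (≤-trans (+-mono-≤ (min-degree a∈) (min-degree b∈)) a+b)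
             (R , uniq , len , square-arith {a = D a S} {b = D b S} {c = D c S} {d = D d S}
               (trans (cong (E S +_) (sym inner)) eq) a+b c+d)
        where
        ab-end : ∀ {w} → a ~ w → b ~ w → All (w ≢_) (h ∷ []) → ⊥
        ab-end aw bw = link-path-end hd hc hb ha (~-sym cd) (~-sym bc) (~-sym ab)
          (≁-sym bd) (≁-sym ac) (b≢d ∘ sym) (a≢c ∘ sym) bw aw
        -- The path closes to a 4-cycle: `a` and `b` have no common neighbour besides `h`, so their
        -- neighbourhoods cover `S`, and `d` is not adjacent to `b`.
        ad : a ~ d
        ad = neighbourhoods-cover (≤-trans n<2p (+-mono-≤ (min-degree a∈) (min-degree b∈))) ab-end d∈ bd
        a+b : D a S + D b S ≤ length S + 1
        a+b = codegree-≤ a b (h ∷ []) ab-end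
        c+d : D c S + D d S ≤ length S + 1
        c+d = codegree-≤ c d (h ∷ []) (link-path-end ha hb hc hd ab bc cd ac bd a≢c b≢d)
        inner : E (a ∷ b ∷ c ∷ d ∷ []) ≡ 4
        inner rewrite ab | ac | ad | bc | bd | cd = refl

      -- `h` has at least two common neighbours with every vertex, so its neighbourhood contains a
      -- walk a, b, c, d that never turns straight back. A chord `a`, `c` or `b`, `d` makes a K₄
      -- with `h`; without chords `delete-C₄` applies.
      reduce-hub : 7 ≤ length S → length S + 1 ≤ p + p → p + 9 ≤ 2 * length S →
        ∀ {h} → h ∈ S → length S + 2 ≤ D h S + p → Reduction p
      reduce-hub 7≤n n<2p p≤ {h} h∈ hub
        with common-neighbour′ h h [] (≤-trans (+-monoʳ-≤ (length S) (s≤s z≤n)) hub) ≤-refl (min-degree h∈)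
      ... | b , b∈ , hb , _
        with common-neighbour′ h b [] (≤-trans (+-monoʳ-≤ (length S) (s≤s z≤n)) hub) ≤-refl (min-degree b∈)
      ... | a , a∈ , ha , ba , _
        with common-neighbour′ h b (a ∷ []) hub ≤-refl (min-degree b∈)
      ... | c , c∈ , hc , bc , (c≢a ∷ [])
        with common-neighbour′ h c (b ∷ []) hub ≤-refl (min-degree c∈)
      ... | d , d∈ , hd , cd , (d≢b ∷ []) with adj a c in ac | adj b d in bd
      ... | true | _ = reduce-K₄ p≤ (n+8<4p _ p n<2p 7≤n)
            ((hb ∷ ha ∷ hc ∷ []) ∷ (ba ∷ bc ∷ []) ∷ (ac ∷ []) ∷ [] ∷ []) (h∈ ∷ b∈ ∷ a∈ ∷ c∈ ∷ [])
      ... | false | true = reduce-K₄ p≤ (n+8<4p _ p n<2p 7≤n)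
            ((hb ∷ hc ∷ hd ∷ []) ∷ (bc ∷ bd ∷ []) ∷ (cd ∷ []) ∷ [] ∷ []) (h∈ ∷ b∈ ∷ c∈ ∷ d∈ ∷ [])
      ... | false | false = delete-C₄ n<2p ha hb hc hd (~-sym ba) bc cd ac bd (c≢a ∘ sym) (d≢b ∘ sym)
            (a∈ ∷ b∈ ∷ c∈ ∷ d∈ ∷ [])

      -- All degrees equal p here, so any two sum to exactly n + 1, as `triangle-arith` requires,
      -- and n + 1 is also enough to find a triangle.
      delete-low-triangle : length S + 1 ≡ p + p → (∃[ v ] v ∈ S) →
        (∀ {v} → v ∈ S → D v S ≤ p) → Reduction p
      delete-low-triangle n+1≡2p (a , a∈) low
        with common-neighbour′ a a [] (≤-reflexive n+1≡2p) (min-degree a∈) (min-degree a∈)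
      ... | b , b∈ , ab , _
        with common-neighbour′ a b [] (≤-reflexive n+1≡2p) (min-degree a∈) (min-degree b∈)
      ... | c , c∈ , ac , bc , _
        with remove ((~⇒≢ ab ∷ ~⇒≢ ac ∷ []) ∷ (~⇒≢ bc ∷ []) ∷ [] ∷ []) (a∈ ∷ b∈ ∷ c∈ ∷ [])
      ... | R , uniq , len , eq = delete-3 (≤-reflexive (sym n+1≡2p)) (R , uniq , len ,
            triangle-arith {u = D a S} {c = D b S} {d = D c S} (trans (cong (E S +_) (sym inner)) eq)
              (low-sum a∈ b∈) (low-sum a∈ c∈) (min-degree a∈))
        where
        low-sum : ∀ {x y} → x ∈ S → y ∈ S → D x S + D y S ≤ length S + 1
        low-sum x∈ y∈ = ≤-trans (+-mono-≤ (low x∈) (low y∈)) (≤-reflexive (sym n+1≡2p))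
        inner : E (a ∷ b ∷ c ∷ []) ≡ 3
        inner rewrite ab | ac | bc = refl

      reduce-odd : 7 ≤ length S → length S + 1 ≡ p + p → p + 9 ≤ 2 * length S → (∃[ v ] v ∈ S) → Reduction p
      reduce-odd 7≤n n+1≡2p p≤ v with any? (λ x → p <? D x S) S
      ... | no none = delete-low-triangle n+1≡2p v (λ x∈ → ≮⇒≥ (λ lt → none (lose x∈ lt)))
      ... | yes some = let h , h∈ , p<h = find some in
            reduce-hub 7≤n (≤-reflexive n+1≡2p) p≤ h∈ (begin
              length S + 2       ≡⟨ +-suc (length S) 1 ⟩
              suc (length S + 1) ≡⟨ cong suc n+1≡2p ⟩
              suc p + p          ≤⟨ +-monoˡ-≤ p p<h ⟩
              D h S + p          ∎)
        where open ≤-Reasoning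

  -- Bounds for small vertex sets

  upper : ∀ {n} → Vec A n → Vec Bool (tri n)
  upper [] = []
  upper (x ∷ xs) = Vec.map (adj x) xs Vec.++ upper xs

  matrix-upper : ∀ {n} (xs : Vec A n) i j → matrix (upper xs) i j ≡ adj (Vec.lookup xs i) (Vec.lookup xs j)
  matrix-upper (x ∷ xs) zero zero = sym (adj-irrefl x)
  matrix-upper (x ∷ xs) zero (suc j)
    rewrite take-++ (Vec.map (adj x) xs) (upper xs) = lookup-map j (adj x) xs
  matrix-upper (x ∷ xs) (suc i) zero
    rewrite take-++ (Vec.map (adj x) xs) (upper xs) = trans (lookup-map i (adj x) xs) (adj-sym x _)
  matrix-upper (x ∷ xs) (suc i) (suc j)
    rewrite drop-++ (Vec.map (adj x) xs) (upper xs) = matrix-upper xs i j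

  E+missing : ∀ xs → E xs + missing (upper (Vec.fromList xs)) ≡ tri (length xs)
  E+missing [] = refl
  E+missing (x ∷ xs)
    rewrite missing-++ (Vec.map (adj x) (Vec.fromList xs)) (upper (Vec.fromList xs))
    = trans (interchange (D x xs) (E xs) _ _) (cong₂ _+_ (row xs) (E+missing xs))
    where
    row : ∀ ys → D x ys + missing (Vec.map (adj x) (Vec.fromList ys)) ≡ length ys
    row [] = refl
    row (y ∷ ys) with adj x y
    ... | true = cong suc (row ys)
    ... | false = trans (+-suc _ _) (cong suc (row ys))

  Bounded : ℕ → ℕ → Set
  Bounded n t = ∀ {S} → Unique S → length S ≡ n → E S ≤ t

  bounded-trivial : ∀ n → Bounded n (tri n)
  bounded-trivial n {S} _ refl = ≤-trans (m≤m+n (E S) _) (≤-reflexive (E+missing S))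

  bounded-6 : Bounded 6 12
  bounded-6 {S@(_ ∷ _ ∷ _ ∷ _ ∷ _ ∷ _ ∷ [])} uniq refl = ≮⇒≥ λ 12<E →
    no-embedding (satisfied (copy-in-dense (upper xs)
      -- K₆ has 15 edges, so 13 edges leave at most two missing.
      (+-cancelˡ-≤ 13 _ _ (≤-trans (+-monoˡ-≤ _ 12<E) (≤-reflexive (E+missing S))))))
    where
    xs : Vec A 6
    xs = Vec.fromList S
    edge : ∀ i j → matrix (upper xs) i j ≡ true → Vec.lookup xs i ~ Vec.lookup xs j
    edge i j = trans (sym (matrix-upper xs i j))
    distinct : ∀ {i j} → i ≢ j → Vec.lookup xs i ≢ Vec.lookup xs j
    distinct i≢j eq = i≢j (lookup-injective (unique-fromList uniq) _ _ eq)
    no-embedding : ∃ (Copy (matrix (upper xs))) → ⊥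
    no-embedding (a ∷ b ∷ c ∷ d ∷ e ∷ f ∷ [] ,
      (ab , ac , bc , bd , cd , ce , de , df , ef) , (ad , ae , af , be , bf , cf)) =
      no-P²₆ (edge a b ab) (edge a c ac) (edge b c bc) (edge b d bd) (edge c d cd)
        (edge c e ce) (edge d e de) (edge d f df) (edge e f ef)
        (distinct ad) (distinct ae) (distinct af) (distinct be) (distinct bf) (distinct cf)

  -- The induction on the number of vertices

  add-low-degree : ∀ {n t p t′} → Bounded n t → p + t ≤ t′ →
    (∀ {S} (uniq : Unique S) → length S ≡ suc n → (∀ {v} → v ∈ S → suc p ≤ D v S) → E S ≤ t′) →
    Bounded (suc n) t′
  add-low-degree {n} {t} {p} {t′} bound p+t≤ high {S} uniq len with any? (λ v → D v S ≤? p) S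
  ... | no none = high uniq len λ v∈ → ≰⇒> λ D≤p → none (lose v∈ D≤p)
  ... | yes some with find some
  ... | v , v∈ , D≤p with remove uniq {v ∷ []} ([] ∷ []) (v∈ ∷ [])
  ... | R , R-uniq , R-len , eq = begin
    E S                ≡⟨ +-identityʳ (E S) ⟨
    E S + 0            ≡⟨ eq ⟩
    D v S + 0 + E R    ≡⟨ cong (_+ E R) (+-identityʳ (D v S)) ⟩
    D v S + E R        ≤⟨ +-mono-≤ D≤p (bound R-uniq (suc-injective (trans (sym R-len) len))) ⟩
    p + t              ≤⟨ p+t≤ ⟩
    t′                 ∎
    where open ≤-Reasoning

  nonempty : ∀ (S : List A) {n} → length S ≡ suc n → ∃[ v ] v ∈ S
  nonempty (x ∷ S) _ = x , here refl

  delete-bound : ∀ {n j m x y t t′ S} (uniq : Unique S) → length S ≡ j + m → Deletion uniq j x y →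
    Bounded m t → y ≡ n → n + t ≤ t′ + x → E S ≤ t′
  delete-bound {n} {j} {m} {x} {y} {t} {t′} {S} uniq len (R , R-uniq , R-len , E≤) bound refl le =
    +-cancelʳ-≤ x _ _ (begin
    E S + x ≤⟨ E≤ ⟩
    y + E R ≤⟨ +-monoʳ-≤ y (bound R-uniq (+-cancelˡ-≡ j _ _ (trans (sym R-len) len))) ⟩
    y + t   ≤⟨ le ⟩
    t′ + x  ∎)
    where open ≤-Reasoning

  step-high : ∀ {n t t′ p} → 6 ≤ n → suc n + 3 ≤ suc p + suc p → Bounded n t → p + t ≤ t′ → Bounded (suc n) t′
  step-high {p = p} 6≤n n≤ bound p+t≤ = add-low-degree bound p+t≤ λ {S} uniq len δ →
    ⊥-elim (min-degree-not-high uniq δ (subst (λ l → l + 3 ≤ suc p + suc p) (sym len) n≤)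
      (subst (7 ≤_) (sym len) (s≤s 6≤n)) (nonempty S len))

  -- Since 2p ≥ n + 2, any vertex can serve as the hub.
  step-even : ∀ {m t₅ t t′ p} → 2 ≤ m → 5 + m + 2 ≤ suc p + suc p → suc p + 9 ≤ 2 * (5 + m) →
    Bounded m t₅ → 3 * (5 + m) + t₅ ≤ t′ + (3 + suc p) →
    Bounded (4 + m) t → p + t ≤ t′ → Bounded (5 + m) t′
  step-even {m} {t₅} {t} {t′} {p} 2≤m n≤ p≤ bound₅ le₅ bound p+t≤ = add-low-degree bound p+t≤ high
    where
    high : ∀ {S} (uniq : Unique S) → length S ≡ 5 + m → (∀ {v} → v ∈ S → suc p ≤ D v S) → E S ≤ t′
    high {S} uniq len δ = conclude (reduce-hub uniq δ
      (≤-trans (+-monoʳ-≤ 5 2≤m) (≤-reflexive (sym len))) (≤-trans (+-monoʳ-≤ (length S) (s≤s z≤n)) n≤′)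
      (subst (λ l → suc p + 9 ≤ 2 * l) (sym len) p≤) h∈ (≤-trans n≤′ (+-monoˡ-≤ (suc p) (δ h∈))))
      where
      h∈ : proj₁ (nonempty S len) ∈ S
      h∈ = proj₂ (nonempty S len)
      n≤′ : length S + 2 ≤ suc p + suc p
      n≤′ = subst (λ l → l + 2 ≤ suc p + suc p) (sym len) n≤
      many : suc p + suc p ≤ length S + 1 → ⊥
      many le = 1+n≰n (≤-trans (≤-reflexive (sym (+-suc (length S) 1))) (≤-trans n≤′ le))
      conclude : Reduction uniq (suc p) → E S ≤ t′
      conclude (delete-5 del) = delete-bound uniq len del bound₅ (cong (3 *_) len) le₅
      conclude (delete-4 le _) = ⊥-elim (many le)
      conclude (delete-3 le _) = ⊥-elim (many le)

  step-odd : ∀ {m t₅ t₄ t₃ t t′ p} → 2 ≤ m → 5 + m + 1 ≡ suc p + suc p → suc p + 9 ≤ 2 * (5 + m) →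
    Bounded m t₅ → 3 * (5 + m) + t₅ ≤ t′ + (3 + suc p) →
    Bounded (1 + m) t₄ → 2 * (5 + m + 1) + t₄ ≤ t′ + 4 →
    Bounded (2 + m) t₃ → 2 * (5 + m + 1) + t₃ ≤ t′ + (3 + suc p) →
    Bounded (4 + m) t → p + t ≤ t′ → Bounded (5 + m) t′
  step-odd {m} {t′ = t′} {p} 2≤m n≡ p≤ bound₅ le₅ bound₄ le₄ bound₃ le₃ bound p+t≤ =
    add-low-degree bound p+t≤ high
    where
    high : ∀ {S} (uniq : Unique S) → length S ≡ 5 + m → (∀ {v} → v ∈ S → suc p ≤ D v S) → E S ≤ t′
    high {S} uniq len δ = conclude (reduce-odd uniq δ
      (≤-trans (+-monoʳ-≤ 5 2≤m) (≤-reflexive (sym len))) (trans (cong (_+ 1) len) n≡)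
      (subst (λ l → suc p + 9 ≤ 2 * l) (sym len) p≤) (nonempty S len))
      where
      conclude : Reduction uniq (suc p) → E S ≤ t′
      conclude (delete-5 del) = delete-bound uniq len del bound₅ (cong (3 *_) len) le₅
      conclude (delete-4 _ del) = delete-bound uniq len del bound₄ (cong (λ l → 2 * (l + 1)) len) le₄
      conclude (delete-3 _ del) = delete-bound uniq len del bound₃ (cong (λ l → 2 * (l + 1)) len) le₃

  -- 6k + 5 is left out because the bound fails for n = 5.
  record Stage (k : ℕ) : Set where
    field
      bound₁ : Bounded (1 + k * 6) (ex₁ k)
      bound₂ : Bounded (2 + k * 6) (ex₂ k)
      bound₃ : Bounded (3 + k * 6) (ex₃ k)
      bound₄ : Bounded (4 + k * 6) (ex₄ k)
      bound₆ : Bounded (6 + k * 6) (ex₆ k)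

  -- Up to four vertices the formula is the size of the complete graph.
  stage₀ : Stage 0
  stage₀ = record
    { bound₁ = bounded-trivial 1
    ; bound₂ = bounded-trivial 2
    ; bound₃ = bounded-trivial 3
    ; bound₄ = bounded-trivial 4
    ; bound₆ = bounded-6
    }

  module Step (k : ℕ) (prev : Stage k) where
    open Stage prev

    -- Each of the four deletion inequalities is an equality here: the formula leaves no spare edge.
    bound₇ : Bounded (7 + k * 6) (ex₁ (suc k))
    bound₇ = step-odd {p = 3 + 3 * k} (m≤m+n 2 _) (p≡ k) (≡+⇒≤ (p≤ k))
      bound₂ (≤-reflexive (le₅ k)) bound₃ (≤-reflexive (le₄ k)) bound₄ (≤-reflexive (le₃ k))
      bound₆ (≤-reflexive (le₁ k))
      where
      p≡ : ∀ k → 7 + k * 6 + 1 ≡ 4 + 3 * k + (4 + 3 * k)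
      p≡ = solve-∀
      p≤ : ∀ k → 2 * (7 + k * 6) ≡ 4 + 3 * k + 9 + (1 + 9 * k)
      p≤ = solve-∀
      le₅ : ∀ k → 3 * (7 + k * 6) + (9 * (k * k) + 9 * k + 1)
        ≡ (9 * ((1 + k) * (1 + k)) + 6 * (1 + k)) + (3 + (4 + 3 * k))
      le₅ = solve-∀
      le₄ : ∀ k → 2 * (7 + k * 6 + 1) + (9 * (k * k) + 12 * k + 3)
        ≡ (9 * ((1 + k) * (1 + k)) + 6 * (1 + k)) + 4
      le₄ = solve-∀
      le₃ : ∀ k → 2 * (7 + k * 6 + 1) + (9 * (k * k) + 15 * k + 6)
        ≡ (9 * ((1 + k) * (1 + k)) + 6 * (1 + k)) + (3 + (4 + 3 * k))
      le₃ = solve-∀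
      le₁ : ∀ k → 3 + 3 * k + (9 * (k * k) + 21 * k + 12) ≡ (9 * ((1 + k) * (1 + k)) + 6 * (1 + k))
      le₁ = solve-∀

    bound₈ : Bounded (8 + k * 6) (ex₂ (suc k))
    bound₈ = step-even {p = 4 + 3 * k} (m≤m+n 2 _) (≤-reflexive (n≡ k)) (≡+⇒≤ (p≤ k))
      bound₃ (≤-reflexive (le₅ k)) bound₇ (≤-reflexive (le₁ k))
      where
      n≡ : ∀ k → 8 + k * 6 + 2 ≡ 5 + 3 * k + (5 + 3 * k)
      n≡ = solve-∀
      p≤ : ∀ k → 2 * (8 + k * 6) ≡ 5 + 3 * k + 9 + (2 + 9 * k)
      p≤ = solve-∀
      le₅ : ∀ k → 3 * (8 + k * 6) + (9 * (k * k) + 12 * k + 3)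
        ≡ (9 * ((1 + k) * (1 + k)) + 9 * (1 + k) + 1) + (3 + (5 + 3 * k))
      le₅ = solve-∀
      le₁ : ∀ k → 4 + 3 * k + (9 * ((1 + k) * (1 + k)) + 6 * (1 + k))
        ≡ (9 * ((1 + k) * (1 + k)) + 9 * (1 + k) + 1)
      le₁ = solve-∀

    bound₉ : Bounded (9 + k * 6) (ex₃ (suc k))
    bound₉ = step-high {p = 5 + 3 * k} (m≤m+n 6 _) (≤-reflexive (n≡ k)) bound₈ (≤-reflexive (le₁ k))
      where
      n≡ : ∀ k → 9 + k * 6 + 3 ≡ 6 + 3 * k + (6 + 3 * k)
      n≡ = solve-∀
      le₁ : ∀ k → 5 + 3 * k + (9 * ((1 + k) * (1 + k)) + 9 * (1 + k) + 1)
        ≡ (9 * ((1 + k) * (1 + k)) + 12 * (1 + k) + 3)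
      le₁ = solve-∀

    bound₁₀ : Bounded (10 + k * 6) (ex₄ (suc k))
    bound₁₀ = step-high {p = 6 + 3 * k} (m≤m+n 6 _) (≡+⇒≤ (n≡ k)) bound₉ (≤-reflexive (le₁ k))
      where
      n≡ : ∀ k → 7 + 3 * k + (7 + 3 * k) ≡ 10 + k * 6 + 3 + 1
      n≡ = solve-∀
      le₁ : ∀ k → 6 + 3 * k + (9 * ((1 + k) * (1 + k)) + 12 * (1 + k) + 3)
        ≡ (9 * ((1 + k) * (1 + k)) + 15 * (1 + k) + 6)
      le₁ = solve-∀

    bound₁₁ : Bounded (11 + k * 6) (ex₅ (suc k))
    bound₁₁ = step-high {p = 6 + 3 * k} (m≤m+n 6 _) (≤-reflexive (n≡ k)) bound₁₀ (≤-reflexive (le₁ k))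
      where
      n≡ : ∀ k → 11 + k * 6 + 3 ≡ 7 + 3 * k + (7 + 3 * k)
      n≡ = solve-∀
      le₁ : ∀ k → 6 + 3 * k + (9 * ((1 + k) * (1 + k)) + 15 * (1 + k) + 6)
        ≡ (9 * ((1 + k) * (1 + k)) + 18 * (1 + k) + 9)
      le₁ = solve-∀

    bound₁₂ : Bounded (12 + k * 6) (ex₆ (suc k))
    bound₁₂ = step-even {p = 6 + 3 * k} (m≤m+n 2 _) (≤-reflexive (n≡ k)) (≡+⇒≤ (p≤ k))
      bound₇ (≡+⇒≤ (le₅ k)) bound₁₁ (≤-reflexive (le₁ k))
      where
      n≡ : ∀ k → 12 + k * 6 + 2 ≡ 7 + 3 * k + (7 + 3 * k)
      n≡ = solve-∀
      p≤ : ∀ k → 2 * (12 + k * 6) ≡ 7 + 3 * k + 9 + (8 + 9 * k)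
      p≤ = solve-∀
      le₅ : ∀ k → (9 * ((1 + k) * (1 + k)) + 21 * (1 + k) + 12) + (3 + (7 + 3 * k))
        ≡ 3 * (12 + k * 6) + (9 * ((1 + k) * (1 + k)) + 6 * (1 + k)) + 1
      le₅ = solve-∀
      le₁ : ∀ k → 6 + 3 * k + (9 * ((1 + k) * (1 + k)) + 18 * (1 + k) + 9)
        ≡ (9 * ((1 + k) * (1 + k)) + 21 * (1 + k) + 12)
      le₁ = solve-∀

    next : Stage (suc k)
    next = record
      { bound₁ = bound₇ ; bound₂ = bound₈ ; bound₃ = bound₉ ; bound₄ = bound₁₀ ; bound₆ = bound₁₂ }

  stage : ∀ k → Stage k
  stage zero = stage₀
  stage (suc k) = Step.next k (stage k)

-- The extremal graphs and the formula

no-copy : ∀ {n} (G : Graph n) → ¬ (P² 6 ⊆G G) → ∀ {a b c d e f} →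
  let _~_ = λ x y → Graph.adj G x y ≡ true in
  a ~ b → a ~ c → b ~ c → b ~ d → c ~ d → c ~ e → d ~ e → d ~ f → e ~ f →
  a ≢ d → a ≢ e → a ≢ f → b ≢ e → b ≢ f → c ≢ f → ⊥
no-copy G free {a} {b} {c} {d} {e} {f} ab ac bc bd cd ce de df ef a≢d a≢e a≢f b≢e b≢f c≢f =
  free (Vec.lookup vs , lookup-injective distinct _ _ , hom)
  where
  vs : Vec (Fin _) 6
  vs = a ∷ b ∷ c ∷ d ∷ e ∷ f ∷ []
  ≢-adj : ∀ {x y} → Graph.adj G x y ≡ true → x ≢ y
  ≢-adj {x} x~x refl = true≢false (trans (sym x~x) (irrefl G x))
  distinct : Uniqueᵛ vs
  distinct = (≢-adj ab ∷ ≢-adj ac ∷ a≢d ∷ a≢e ∷ a≢f ∷ []) ∷ (≢-adj bc ∷ ≢-adj bd ∷ b≢e ∷ b≢f ∷ []) ∷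
    (≢-adj cd ∷ ≢-adj ce ∷ c≢f ∷ []) ∷ (≢-adj de ∷ ≢-adj df ∷ []) ∷ (≢-adj ef ∷ []) ∷ [] ∷ []
  hom : ∀ i j → P²-adj i j ≡ true → Graph.adj G (Vec.lookup vs i) (Vec.lookup vs j) ≡ true
  hom 0F 1F refl = ab
  hom 0F 2F refl = ac
  hom 1F 2F refl = bc
  hom 1F 3F refl = bd
  hom 2F 3F refl = cd
  hom 2F 4F refl = ce
  hom 3F 4F refl = de
  hom 3F 5F refl = df
  hom 4F 5F refl = ef
  hom 1F 0F refl = trans (Graph.sym G b a) ab
  hom 2F 0F refl = trans (Graph.sym G c a) ac
  hom 2F 1F refl = trans (Graph.sym G c b) bc
  hom 3F 1F refl = trans (Graph.sym G d b) bd
  hom 3F 2F refl = trans (Graph.sym G d c) cd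
  hom 4F 2F refl = trans (Graph.sym G e c) ce
  hom 4F 3F refl = trans (Graph.sym G e d) de
  hom 5F 3F refl = trans (Graph.sym G f d) df
  hom 5F 4F refl = trans (Graph.sym G f e) ef
  hom 5F 5F ()

module _ {A : Set} (adjA : A → A → Bool)
  (symA : ∀ x y → adjA x y ≡ adjA y x) (irreflA : ∀ x → adjA x x ≡ false) where
  open EdgeCount adjA symA irreflA

  sumFin-tabulate : ∀ n (f : Fin n → A) x →
    sumFin n (λ j → if adjA x (f j) then 1 else 0) ≡ D x (tabulate f)
  sumFin-tabulate zero f x = refl
  sumFin-tabulate (suc n) f x = cong ([ adjA x (f zero) ] +_) (sumFin-tabulate n (f ∘ suc) x)

  edges-tabulate : ∀ n (f : Fin n → A) →
    sumFin n (λ i → sumFin n (λ j → if (toℕ i <ᵇ toℕ j) ∧ adjA (f i) (f j) then 1 else 0))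
      ≡ E (tabulate f)
  edges-tabulate zero f = refl
  edges-tabulate (suc n) f = cong₂ _+_ (sumFin-tabulate n (f ∘ suc) (f zero)) (edges-tabulate n (f ∘ suc))

module Upper {n} (G : Graph n) (free : ¬ (P² 6 ⊆G G)) where
  open Square-path-free (Fin._≟_ {n}) (Graph.adj G) (Graph.sym G) (irrefl G) (no-copy G free) public

  edges-≤ : ∀ {t} → Bounded n t → edges G ≤ t
  edges-≤ bound = ≤-trans (≤-reflexive (edges-tabulate (Graph.adj G) (Graph.sym G) (irrefl G) n (λ i → i)))
    (bound (allFin⁺ n) (length-tabulate {n = n} (λ i → i)))

-- The extremal graphs are nested: the complete bipartite graph between the x's and the y's, plus a
-- triangle on each {x k 0, x k 1, x k 2}.
data Vertex : Set where
  x y : ℕ → Fin 3 → Vertex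

_—_ : Vertex → Vertex → Bool
x k i — x l j = (k ≡ᵇ l) ∧ not (does (i Fin.≟ j))
x _ _ — y _ _ = true
y _ _ — x _ _ = true
y _ _ — y _ _ = false

—-irrefl : ∀ u → u — u ≡ false
—-irrefl (x k i) rewrite dec-true (k ℕ.≟ k) refl | dec-true (i Fin.≟ i) refl = refl
—-irrefl (y k i) = refl

—-sym : ∀ u v → u — v ≡ v — u
—-sym (x k i) (x l j) = cong₂ (λ a b → a ∧ not b)
  (does-sym (k ℕ.≟ l) (l ℕ.≟ k)) (does-sym (i Fin.≟ j) (j Fin.≟ i))
  where
  does-sym : ∀ {A : Set} {u v : A} (p : Dec (u ≡ v)) (q : Dec (v ≡ u)) → does p ≡ does q
  does-sym (yes refl) q = sym (dec-true q refl)
  does-sym (no u≢v) q = sym (dec-false q (u≢v ∘ sym))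
—-sym (x _ _) (y _ _) = refl
—-sym (y _ _) (x _ _) = refl
—-sym (y _ _) (y _ _) = refl

same-triangle : ∀ k l i j → x k i — x l j ≡ true → k ≡ l × i ≢ j
same-triangle k l i j eq with k ≡ᵇ l in k≡ᵇl | i Fin.≟ j | eq
... | true | no i≢j | _ = ≡ᵇ⇒≡ k l (subst Bool.T (sym k≡ᵇl) _) , i≢j
... | true | yes _ | ()
... | false | _ | ()

-- A path stays inside one triangle, which has no room for four distinct vertices.
no-x-path : ∀ {k₁ k₂ k₃ k₄ i₁ i₂ i₃ i₄} →
  x k₁ i₁ — x k₂ i₂ ≡ true → x k₂ i₂ — x k₃ i₃ ≡ true → x k₃ i₃ — x k₄ i₄ ≡ true →
  x k₁ i₁ ≢ x k₃ i₃ → x k₁ i₁ ≢ x k₄ i₄ → x k₂ i₂ ≢ x k₄ i₄ → ⊥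
no-x-path {k₁} {k₂} {k₃} {k₄} {i₁} {i₂} {i₃} {i₄} p q r 1≢3 1≢4 2≢4
  with same-triangle k₁ k₂ i₁ i₂ p | same-triangle k₂ k₃ i₂ i₃ q | same-triangle k₃ k₄ i₃ i₄ r
... | refl , i₁≢i₂ | refl , i₂≢i₃ | refl , i₃≢i₄ =
  1+n≰n (injective⇒≤ (lookup-injective distinct _ _))
  where
  distinct : Uniqueᵛ (i₁ ∷ i₂ ∷ i₃ ∷ i₄ ∷ [])
  distinct = (i₁≢i₂ ∷ (1≢3 ∘ cong (x _)) ∷ (1≢4 ∘ cong (x _)) ∷ []) ∷
    (i₂≢i₃ ∷ (2≢4 ∘ cong (x _)) ∷ []) ∷ (i₃≢i₄ ∷ []) ∷ [] ∷ []

—⇒≢ : ∀ {u v} → u — v ≡ true → u ≢ v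
—⇒≢ {u} u—u refl = true≢false (trans (sym u—u) (—-irrefl u))

-- The y's are independent, and every maximal independent set of the square of the path leaves a path
-- on four vertices.
no-P²₆-Vertex : ∀ a b c d e f →
  a — b ≡ true → a — c ≡ true → b — c ≡ true → b — d ≡ true → c — d ≡ true →
  c — e ≡ true → d — e ≡ true → d — f ≡ true → e — f ≡ true →
  a ≢ d → a ≢ e → a ≢ f → b ≢ e → b ≢ f → c ≢ f → ⊥
no-P²₆-Vertex (y _ _) (y _ _) _ _ _ _ () _ _ _ _ _ _ _ _
no-P²₆-Vertex (y _ _) _ (y _ _) _ _ _ _ () _ _ _ _ _ _ _
no-P²₆-Vertex _ (y _ _) (y _ _) _ _ _ _ _ () _ _ _ _ _ _
no-P²₆-Vertex _ (y _ _) _ (y _ _) _ _ _ _ _ () _ _ _ _ _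
no-P²₆-Vertex _ _ (y _ _) (y _ _) _ _ _ _ _ _ () _ _ _ _
no-P²₆-Vertex _ _ (y _ _) _ (y _ _) _ _ _ _ _ _ () _ _ _
no-P²₆-Vertex _ _ _ (y _ _) (y _ _) _ _ _ _ _ _ _ () _ _
no-P²₆-Vertex _ _ _ (y _ _) _ (y _ _) _ _ _ _ _ _ _ () _
no-P²₆-Vertex _ _ _ _ (y _ _) (y _ _) _ _ _ _ _ _ _ _ ()
no-P²₆-Vertex _ (x _ _) (x _ _) _ (x _ _) (x _ _) ab ac bc bd cd ce de df ef ad ae af be bf cf =
  no-x-path bc ce ef be bf cf
no-P²₆-Vertex _ (x _ _) (x _ _) (x _ _) _ (x _ _) ab ac bc bd cd ce de df ef ad ae af be bf cf =
  no-x-path bc cd df (—⇒≢ bd) bf cf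
no-P²₆-Vertex _ (x _ _) (x _ _) (x _ _) (x _ _) _ ab ac bc bd cd ce de df ef ad ae af be bf cf =
  no-x-path bc cd de (—⇒≢ bd) be (—⇒≢ ce)
no-P²₆-Vertex (x _ _) _ (x _ _) (x _ _) _ (x _ _) ab ac bc bd cd ce de df ef ad ae af be bf cf =
  no-x-path ac cd df ad af cf
no-P²₆-Vertex (x _ _) _ (x _ _) (x _ _) (x _ _) _ ab ac bc bd cd ce de df ef ad ae af be bf cf =
  no-x-path ac cd de ad ae (—⇒≢ ce)
no-P²₆-Vertex (x _ _) (x _ _) _ (x _ _) (x _ _) _ ab ac bc bd cd ce de df ef ad ae af be bf cf =
  no-x-path ab bd de ad ae be

-- Each block of six is listed as y, x, x, x, y, y. The new vertex then has degree 3k, 3k + 1, 3k +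
-- 2 and three times 3k + 3 towards its predecessors, matching the increments of `exP6`, so one
-- sequence serves all residues.
next : Vertex → Vertex
next (y k 0F) = x k 0F
next (x k 0F) = x k 1F
next (x k 1F) = x k 2F
next (x k 2F) = y k 1F
next (y k 1F) = y k 2F
next (y k 2F) = y (suc k) 0F

nth : ℕ → Vertex
nth zero = y 0 0F
nth (suc n) = next (nth n)

-- The position in the enumeration; it shows that `nth` never repeats a vertex.
rank : Vertex → ℕ
rank (y k 0F) = k * 6
rank (x k i) = suc (toℕ i) + k * 6
rank (y k 1F) = 4 + k * 6
rank (y k 2F) = 5 + k * 6

rank-nth : ∀ n → rank (nth n) ≡ n
rank-nth zero = refl
rank-nth (suc n) = trans (rank-next (nth n)) (cong suc (rank-nth n))
  where
  rank-next : ∀ u → rank (next u) ≡ suc (rank u)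
  rank-next (y k 0F) = refl
  rank-next (x k 0F) = refl
  rank-next (x k 1F) = refl
  rank-next (x k 2F) = refl
  rank-next (y k 1F) = refl
  rank-next (y k 2F) = refl

-- Listed from the last vertex down, so that tabulating over Fin (suc n) puts the new vertex first.
vertex : ∀ {n} → Fin n → Vertex
vertex {suc n} zero = nth n
vertex {suc n} (suc i) = vertex i

vertex-injective : ∀ {n} (i j : Fin n) → vertex i ≡ vertex j → i ≡ j
vertex-injective zero zero _ = refl
vertex-injective (suc i) (suc j) eq = cong suc (vertex-injective i j eq)
vertex-injective {suc n} zero (suc j) eq = ⊥-elim (n≮n n
  (subst (_< n) (trans (cong rank (sym eq)) (rank-nth n)) (rank-vertex j)))
  where
  rank-vertex : ∀ {n} (i : Fin n) → rank (vertex i) < n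
  rank-vertex {suc n} zero = s≤s (≤-reflexive (rank-nth n))
  rank-vertex {suc n} (suc i) = m≤n⇒m≤1+n (rank-vertex i)
vertex-injective (suc i) zero eq = sym (vertex-injective zero (suc i) (sym eq))

extremal : ∀ n → Graph n
extremal n = record
  { adj = λ i j → vertex i — vertex j
  ; sym = λ i j → —-sym (vertex i) (vertex j)
  ; irrefl = λ i → —-irrefl (vertex i)
  }

extremal-free : ∀ n → ¬ (P² 6 ⊆G extremal n)
extremal-free n (f , f-inj , hom) = no-P²₆-Vertex (v 0F) (v 1F) (v 2F) (v 3F) (v 4F) (v 5F)
  (hom 0F 1F refl) (hom 0F 2F refl) (hom 1F 2F refl) (hom 1F 3F refl) (hom 2F 3F refl)
  (hom 2F 4F refl) (hom 3F 4F refl) (hom 3F 5F refl) (hom 4F 5F refl)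
  (≢v λ ()) (≢v λ ()) (≢v λ ()) (≢v λ ()) (≢v λ ()) (≢v λ ())
  where
  v : Fin 6 → Vertex
  v i = vertex (f i)
  ≢v : ∀ {i j} → i ≢ j → v i ≢ v j
  ≢v i≢j eq = i≢j (f-inj (vertex-injective _ _ eq))

-- Counting the edges of the extremal graphs

open EdgeCount _—_ —-sym —-irrefl

first : ℕ → List Vertex
first zero = []
first (suc n) = nth n ∷ first n

edges-extremal : ∀ n → edges (extremal n) ≡ E (first n)
edges-extremal n = trans (edges-tabulate _—_ —-sym —-irrefl n vertex) (cong E (tabulate-vertex n))
  where
  tabulate-vertex : ∀ n → tabulate (vertex {n}) ≡ first n
  tabulate-vertex zero = refl
  tabulate-vertex (suc n) = cong (nth n ∷_) (tabulate-vertex n)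

nth-*6 : ∀ k → nth (k * 6) ≡ y k 0F
nth-*6 zero = refl
nth-*6 (suc k) rewrite nth-*6 k = refl

D-y : ∀ l j k → D (y l j) (first (k * 6)) ≡ k * 3
D-y l j zero = refl
D-y l j (suc k) rewrite nth-*6 k | D-y l j k = refl

-- `k ≤ l` keeps the triangle of the vertex out of the first k blocks, so only their 3k y's are
-- adjacent to it.
D-x : ∀ {l} i k → k ≤ l → D (x l i) (first (k * 6)) ≡ k * 3
D-x i zero _ = refl
D-x {l} i (suc k) k<l rewrite nth-*6 k | dec-false (l ℕ.≟ k) (<⇒≢ k<l ∘ sym) | D-x i k (<⇒≤ k<l) = refl

D₀ : ∀ k → D (nth (k * 6)) (first (k * 6)) ≡ k * 3
D₀ k rewrite nth-*6 k = D-y k 0F k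

D₁ : ∀ k → D (nth (1 + k * 6)) (first (1 + k * 6)) ≡ 1 + k * 3
D₁ k rewrite nth-*6 k = cong suc (D-x 0F k ≤-refl)

D₂ : ∀ k → D (nth (2 + k * 6)) (first (2 + k * 6)) ≡ 2 + k * 3
D₂ k rewrite nth-*6 k | dec-true (k ℕ.≟ k) refl = cong (2 +_) (D-x 1F k ≤-refl)

D₃ : ∀ k → D (nth (3 + k * 6)) (first (3 + k * 6)) ≡ 3 + k * 3
D₃ k rewrite nth-*6 k | dec-true (k ℕ.≟ k) refl = cong (3 +_) (D-x 2F k ≤-refl)

D₄ : ∀ k → D (nth (4 + k * 6)) (first (4 + k * 6)) ≡ 3 + k * 3
D₄ k rewrite nth-*6 k = cong (3 +_) (D-y k 1F k)

D₅ : ∀ k → D (nth (5 + k * 6)) (first (5 + k * 6)) ≡ 3 + k * 3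
D₅ k rewrite nth-*6 k = cong (3 +_) (D-y k 2F k)

E₀ : ∀ k → E (first (k * 6)) ≡ 9 * (k * k) + 3 * k
E₁ : ∀ k → E (first (1 + k * 6)) ≡ ex₁ k
E₂ : ∀ k → E (first (2 + k * 6)) ≡ ex₂ k
E₃ : ∀ k → E (first (3 + k * 6)) ≡ ex₃ k
E₄ : ∀ k → E (first (4 + k * 6)) ≡ ex₄ k
E₅ : ∀ k → E (first (5 + k * 6)) ≡ ex₅ k
E₆ : ∀ k → E (first (6 + k * 6)) ≡ ex₆ k

E₀ zero = refl
E₀ (suc k) = trans (E₆ k) (poly k)
  where
  poly : ∀ k → 9 * (k * k) + 21 * k + 12 ≡ 9 * ((1 + k) * (1 + k)) + 3 * (1 + k)
  poly = solve-∀
E₁ k = trans (cong₂ _+_ (D₀ k) (E₀ k)) (poly k)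
  where
  poly : ∀ k → k * 3 + (9 * (k * k) + 3 * k) ≡ 9 * (k * k) + 6 * k
  poly = solve-∀
E₂ k = trans (cong₂ _+_ (D₁ k) (E₁ k)) (poly k)
  where
  poly : ∀ k → 1 + k * 3 + (9 * (k * k) + 6 * k) ≡ 9 * (k * k) + 9 * k + 1
  poly = solve-∀
E₃ k = trans (cong₂ _+_ (D₂ k) (E₂ k)) (poly k)
  where
  poly : ∀ k → 2 + k * 3 + (9 * (k * k) + 9 * k + 1) ≡ 9 * (k * k) + 12 * k + 3
  poly = solve-∀
E₄ k = trans (cong₂ _+_ (D₃ k) (E₃ k)) (poly k)
  where
  poly : ∀ k → 3 + k * 3 + (9 * (k * k) + 12 * k + 3) ≡ 9 * (k * k) + 15 * k + 6
  poly = solve-∀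
E₅ k = trans (cong₂ _+_ (D₄ k) (E₄ k)) (poly k)
  where
  poly : ∀ k → 3 + k * 3 + (9 * (k * k) + 15 * k + 6) ≡ 9 * (k * k) + 18 * k + 9
  poly = solve-∀
E₆ k = trans (cong₂ _+_ (D₅ k) (E₅ k)) (poly k)
  where
  poly : ∀ k → 3 + k * 3 + (9 * (k * k) + 18 * k + 9) ≡ 9 * (k * k) + 21 * k + 12
  poly = solve-∀

-- The formula as a polynomial on each residue class

exP6-by-residue : ℕ → ℕ → ℕ
exP6-by-residue n 1 = (n * n) / 4 + (n ∸ 1) / 2
exP6-by-residue n 2 = (n * n) / 4 + (n ∸ 1) / 2
exP6-by-residue n 3 = (n * n) / 4 + (n ∸ 1) / 2
exP6-by-residue n _ = (n * n) / 4 + (n + 1) / 2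

-- `exP6` inspects `n % 6` through a `with`, which is stuck at `r + k * 6`; once the residue is an
-- argument it can be replaced by an equal one.
exP6-residue : ∀ n → exP6 n ≡ exP6-by-residue n (n % 6)
exP6-residue n with n % 6
... | 0 = refl
... | 1 = refl
... | 2 = refl
... | 3 = refl
... | suc (suc (suc (suc _))) = refl

exP6-mod : ∀ r k → exP6 (r + k * 6) ≡ exP6-by-residue (r + k * 6) (r % 6)
exP6-mod r k = trans (exP6-residue (r + k * 6)) (cong (exP6-by-residue (r + k * 6)) ([m+kn]%n≡m%n r k 6))

quotient : ∀ {m} s q d .{{_ : NonZero d}} → s < d → m ≡ s + q * d → m / d ≡ q
quotient s q d s<d refl = trans (+-distrib-/-∣ʳ s (n∣m*n q))
  (cong₂ _+_ (m<n⇒m/n≡0 s<d) (m*n/n≡m q d))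

exP6₁ : ∀ k → exP6 (1 + k * 6) ≡ ex₁ k
exP6₁ k = trans (exP6-mod 1 k) (trans
  (cong₂ _+_ (quotient 1 (9 * (k * k) + 3 * k) 4 (≤ᵇ⇒≤ 2 4 _) (sq k))
    (quotient 0 (3 * k) 2 (≤ᵇ⇒≤ 1 2 _) (half k)))
  (poly k))
  where
  sq : ∀ k → (1 + k * 6) * (1 + k * 6) ≡ 1 + (9 * (k * k) + 3 * k) * 4
  sq = solve-∀
  half : ∀ k → k * 6 ≡ 3 * k * 2
  half = solve-∀
  poly : ∀ k → 9 * (k * k) + 3 * k + 3 * k ≡ 9 * (k * k) + 6 * k
  poly = solve-∀

exP6₂ : ∀ k → exP6 (2 + k * 6) ≡ ex₂ k
exP6₂ k = trans (exP6-mod 2 k) (trans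
  (cong₂ _+_ (quotient 0 (9 * (k * k) + 6 * k + 1) 4 (≤ᵇ⇒≤ 1 4 _) (sq k))
    (quotient 1 (3 * k) 2 (≤ᵇ⇒≤ 2 2 _) (half k)))
  (poly k))
  where
  sq : ∀ k → (2 + k * 6) * (2 + k * 6) ≡ (9 * (k * k) + 6 * k + 1) * 4
  sq = solve-∀
  half : ∀ k → 1 + k * 6 ≡ 1 + 3 * k * 2
  half = solve-∀
  poly : ∀ k → 9 * (k * k) + 6 * k + 1 + 3 * k ≡ 9 * (k * k) + 9 * k + 1
  poly = solve-∀

exP6₃ : ∀ k → exP6 (3 + k * 6) ≡ ex₃ k
exP6₃ k = trans (exP6-mod 3 k) (trans
  (cong₂ _+_ (quotient 1 (9 * (k * k) + 9 * k + 2) 4 (≤ᵇ⇒≤ 2 4 _) (sq k))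
    (quotient 0 (3 * k + 1) 2 (≤ᵇ⇒≤ 1 2 _) (half k)))
  (poly k))
  where
  sq : ∀ k → (3 + k * 6) * (3 + k * 6) ≡ 1 + (9 * (k * k) + 9 * k + 2) * 4
  sq = solve-∀
  half : ∀ k → 2 + k * 6 ≡ (3 * k + 1) * 2
  half = solve-∀
  poly : ∀ k → 9 * (k * k) + 9 * k + 2 + (3 * k + 1) ≡ 9 * (k * k) + 12 * k + 3
  poly = solve-∀

exP6₄ : ∀ k → exP6 (4 + k * 6) ≡ ex₄ k
exP6₄ k = trans (exP6-mod 4 k) (trans
  (cong₂ _+_ (quotient 0 (9 * (k * k) + 12 * k + 4) 4 (≤ᵇ⇒≤ 1 4 _) (sq k))
    (quotient 1 (3 * k + 2) 2 (≤ᵇ⇒≤ 2 2 _) (half k)))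
  (poly k))
  where
  sq : ∀ k → (4 + k * 6) * (4 + k * 6) ≡ (9 * (k * k) + 12 * k + 4) * 4
  sq = solve-∀
  half : ∀ k → 4 + k * 6 + 1 ≡ 1 + (3 * k + 2) * 2
  half = solve-∀
  poly : ∀ k → 9 * (k * k) + 12 * k + 4 + (3 * k + 2) ≡ 9 * (k * k) + 15 * k + 6
  poly = solve-∀

exP6₅ : ∀ k → exP6 (5 + k * 6) ≡ ex₅ k
exP6₅ k = trans (exP6-mod 5 k) (trans
  (cong₂ _+_ (quotient 1 (9 * (k * k) + 15 * k + 6) 4 (≤ᵇ⇒≤ 2 4 _) (sq k))
    (quotient 0 (3 * k + 3) 2 (≤ᵇ⇒≤ 1 2 _) (half k)))
  (poly k))
  where
  sq : ∀ k → (5 + k * 6) * (5 + k * 6) ≡ 1 + (9 * (k * k) + 15 * k + 6) * 4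
  sq = solve-∀
  half : ∀ k → 5 + k * 6 + 1 ≡ (3 * k + 3) * 2
  half = solve-∀
  poly : ∀ k → 9 * (k * k) + 15 * k + 6 + (3 * k + 3) ≡ 9 * (k * k) + 18 * k + 9
  poly = solve-∀

exP6₆ : ∀ k → exP6 (6 + k * 6) ≡ ex₆ k
exP6₆ k = trans (exP6-mod 6 k) (trans
  (cong₂ _+_ (quotient 0 (9 * (k * k) + 18 * k + 9) 4 (≤ᵇ⇒≤ 1 4 _) (sq k))
    (quotient 1 (3 * k + 3) 2 (≤ᵇ⇒≤ 2 2 _) (half k)))
  (poly k))
  where
  sq : ∀ k → (6 + k * 6) * (6 + k * 6) ≡ (9 * (k * k) + 18 * k + 9) * 4
  sq = solve-∀
  half : ∀ k → 6 + k * 6 + 1 ≡ 1 + (3 * k + 3) * 2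
  half = solve-∀
  poly : ∀ k → 9 * (k * k) + 18 * k + 9 + (3 * k + 3) ≡ 9 * (k * k) + 21 * k + 12
  poly = solve-∀

isEx : ∀ n {t} → exP6 n ≡ t → E (first n) ≡ t →
  (∀ (G : Graph n) (free : ¬ (P² 6 ⊆G G)) → Upper.Bounded G free n t) → IsEx n (P² 6) (exP6 n)
isEx n refl lower upper = (extremal n , extremal-free n , trans (edges-extremal n) lower) ,
  λ G free → Upper.edges-≤ G free (upper G free)

theorem7 : (n : ℕ) → 0 < n → n ≢ 5 → IsEx n (P² 6) (exP6 n)
theorem7 (suc n) _ n≢5 with n divMod 6
... | result k 0F refl = isEx _ (exP6₁ k) (E₁ k) λ G free → let open Upper G free in Stage.bound₁ (stage k)
... | result k 1F refl = isEx _ (exP6₂ k) (E₂ k) λ G free → let open Upper G free in Stage.bound₂ (stage k)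
... | result k 2F refl = isEx _ (exP6₃ k) (E₃ k) λ G free → let open Upper G free in Stage.bound₃ (stage k)
... | result k 3F refl = isEx _ (exP6₄ k) (E₄ k) λ G free → let open Upper G free in Stage.bound₄ (stage k)
... | result zero 4F refl = ⊥-elim (n≢5 refl)
... | result (suc k) 4F refl = isEx _ (exP6₅ (suc k)) (E₅ (suc k)) λ G free →
      let open Upper G free in Step.bound₁₁ k (stage k)
... | result k 5F refl = isEx _ (exP6₆ k) (E₆ k) λ G free → let open Upper G free in Stage.bound₆ (stage k)
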